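{- For an integer $m\ge0$ let $\mathbf{S}_m=\{1,\dots,m\}^2$, where a square $(i,j)$ has column $i$ and row $j$. Two distinct squares $(i,j),(i',j')$ attack each other (as anassas, with moves $(0,1)$ and $(1,1)$) if $i=i'$ or $i-j=i'-j'$. Let $A_{\mathbf{S}}(m,k,p)$ be the number of $k$-element subsets of $\mathbf{S}_m$ with no two elements attacking each other and with exactly $p$ elements $(i,j)$ satisfying $j<i$ (strictly below the main diagonal); set $A_{\mathbf{S}}(m,k,p)=0$ if $k<0$ or $p<0$. Then for integers $m\ge1$ and $k,p\ge 0$, $$A_{\mathbf{S}}(m,k,p)=A_{\mathbf{S}}(m-1,k,p)+(m-k+1)A_{\mathbf{S}}(m-1,k-1,p)+(m-p)A_{\mathbf{S}}(m-1,k-1,p-1)+(m-p)(m-k+1)A_{\mathbf{S}}(m-1,k-2,p-1),$$ with $A_{\mathbf{S}}(0,k,p)=\delta_{k0}\delta_{p0}$, $A_{\mathbf{S}}(m,0,p)=\delta_{p0}$, $A_{\mathbf{S}}(m,1,p)=\left\{ {m+1 \atop m}\right\}\delta_{p0}+\left\{ {m \atop m-1}\right\}\delta_{p1}$ and $A_{\mathbf{S}}(m,k,0)=\left\{ {m+1 \atop m-k+1}\right\}$. Moreover, for all integers $m,k,p\ge0$, $$A_{\mathbf{S}}(m,k,p)=\sum_{j=0}^{p}(m-k+j)_j\binom{k-p-1}{j}\binom{k-j}{k-p}\left\{ {m+1 \atop m-k+j+1}\right\}.$$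
   Context: $\delta_{ij}$ is the Kronecker delta and $(x)_j=x(x-1)\cdots(x-j+1)$, $(x)_0=1$. Stirling numbers of the second kind $\left\{ {n \atop r}\right\}$ are used in the extended sense for all integers: usual values for $n,r\ge0$; $\left\{ {n \atop r}\right\}=\left[{ -r\atop -n}\right]$ (unsigned Stirling number of the first kind) for $n,r\le0$; and $0$ when one of $n,r$ is positive and the other negative. Binomial coefficients are extended to all integers $n,r$ (Kronenburg's convention): $\binom{n}{r}=n(n-1)\cdots(n-r+1)/r!$ if $r\ge0$; $\binom{n}{r}=(-1)^{n-r}\binom{ -r-1}{n-r}$ if $r\le n<0$; and $\binom{n}{r}=0$ otherwise. -}

module Defs where

open import Data.Bool.Base using (if_then_else_)
open import Data.Integer.Base as ℤ using (ℤ; +_; -[1+_]; 0ℤ; 1ℤ; -1ℤ; ∣_∣)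
import Data.Integer.DivMod as ℤ
import Data.Integer.Properties as ℤ
open import Data.List.Base using (List; []; _∷_; _++_; map; length; filter; foldr; applyUpTo; cartesianProduct)
open import Data.List.Relation.Unary.AllPairs using (AllPairs; allPairs?)
open import Data.Nat.Base using (ℕ; zero; suc; _+_; _*_; _<_; _!)
open import Data.Nat.Properties using (_≟_; _<?_; _!≢0)
open import Data.Product.Base using (_×_; _,_; proj₁; proj₂)
open import Data.Product.Properties using (≡-dec)
open import Data.Sum.Base using (_⊎_)
open import Relation.Binary.PropositionalEquality using (_≡_; _≢_)
open import Relation.Nullary using (¬_; Dec; does; ¬?; _×-dec_; _⊎-dec_)

-- (column , row)
Square : Set
Square = ℕ × ℕ

column row : Square → ℕ
column = proj₁
row    = proj₂

Attacks : Square → Square → Set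
Attacks s t = s ≢ t ×
  (column s ≡ column t ⊎ + column s ℤ.- + row s ≡ + column t ℤ.- + row t)

attacks? : ∀ s t → Dec (Attacks s t)
attacks? s t = ¬? (≡-dec _≟_ _≟_ s t) ×-dec
  (column s ≟ column t ⊎-dec (+ column s ℤ.- + row s) ℤ.≟ (+ column t ℤ.- + row t))

BelowDiagonal : Square → Set
BelowDiagonal s = row s < column s

belowDiagonal? : ∀ s → Dec (BelowDiagonal s)
belowDiagonal? s = row s <? column s

-- {1,…,m}², each square listed exactly once
board : ℕ → List Square
board m = cartesianProduct (applyUpTo suc m) (applyUpTo suc m)

-- The sublists of xs. When xs has no repeated entries, each subset of its
-- entries is represented by exactly one of these lists.
subsets : ∀ {a} {A : Set a} → List A → List (List A)
subsets []       = [] ∷ []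
subsets (x ∷ xs) = subsets xs ++ map (x ∷_) (subsets xs)

Placement : ℕ → ℕ → List Square → Set
Placement k p P = length P ≡ k
                × AllPairs (λ s t → ¬ Attacks s t) P
                × length (filter belowDiagonal? P) ≡ p

placement? : ∀ k p P → Dec (Placement k p P)
placement? k p P = length P ≟ k
             ×-dec allPairs? (λ s t → ¬? (attacks? s t)) P
             ×-dec length (filter belowDiagonal? P) ≟ p

A-S : ℕ → ℤ → ℤ → ℕ
A-S m (+ k)    (+ p)    = length (filter (placement? k p) (subsets (board m)))
A-S m (+ _)    -[1+ _ ] = 0
A-S m -[1+ _ ] _        = 0

δ : ℕ → ℕ → ℤ
δ i j = if does (i ≟ j) then 1ℤ else 0ℤ

fallingFactorial : ℤ → ℕ → ℤ
fallingFactorial x zero    = 1ℤ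
fallingFactorial x (suc j) = fallingFactorial x j ℤ.* (x ℤ.- + j)

stirling₁ : ℕ → ℕ → ℕ
stirling₁ zero    zero    = 1
stirling₁ zero    (suc r) = 0
stirling₁ (suc n) zero    = 0
stirling₁ (suc n) (suc r) = n * stirling₁ n (suc r) + stirling₁ n r

stirling₂ : ℕ → ℕ → ℕ
stirling₂ zero    zero    = 1
stirling₂ zero    (suc r) = 0
stirling₂ (suc n) zero    = 0
stirling₂ (suc n) (suc r) = suc r * stirling₂ n (suc r) + stirling₂ n r

-- Second kind, extended to all integers; first kind with negated and swapped
-- arguments on n , r ≤ 0 (both readings give 1 at n = r = 0).
stirling₂ℤ : ℤ → ℤ → ℕ
stirling₂ℤ (+ n)       (+ r)       = stirling₂ n r
stirling₂ℤ (+ zero)    -[1+ r ]    = stirling₁ (suc r) zero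
stirling₂ℤ (+ (suc _)) -[1+ _ ]    = 0
stirling₂ℤ -[1+ n ]    (+ zero)    = stirling₁ zero (suc n)
stirling₂ℤ -[1+ _ ]    (+ (suc _)) = 0
stirling₂ℤ -[1+ n ]    -[1+ r ]    = stirling₁ (suc r) (suc n)

-- n (n-1) ⋯ (n-r+1) / r!; the division is always exact
binomial⁺ : ℤ → ℕ → ℤ
binomial⁺ n r = (fallingFactorial n r ℤ./ℕ (r !)) {{r !≢0}}

-- Kronenburg's extension to all integers
binomial : ℤ → ℤ → ℤ
binomial n (+ r)      = binomial⁺ n r
binomial n r@(-[1+ _ ]) =
  if does ((r ℤ.≤? n) ×-dec (n ℤ.<? 0ℤ))
  then (-1ℤ ℤ.^ ∣ n ℤ.- r ∣) ℤ.* binomial⁺ (ℤ.- r ℤ.- 1ℤ) ∣ n ℤ.- r ∣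
  else 0ℤ

∑₀ : ℕ → (ℕ → ℤ) → ℤ
∑₀ p f = foldr ℤ._+_ 0ℤ (applyUpTo f (suc p))

syntax ∑₀ p (λ j → e) = ∑[ j from0to p ] e

{-# OPTIONS --safe #-}

-- Shifting every square on or above the main diagonal up by one row embeds the
-- board of side m into the board of side m + 1, preserving attacks and the
-- number of pieces below the diagonal. What is left over is the main diagonal
-- and the part of column m + 1 below it, two sets of mutually attacking squares.
-- The latter meets each diagonal below the main one exactly once, so a placement
-- with p pieces below the diagonal leaves m - p of its squares free; the main
-- diagonal meets each of the m + 1 columns exactly once, so k pieces leave
-- m + 1 - k of its squares free. This gives the recurrence.
--
-- Write q = k - p and n = m - k. For q = 0 the closed form telescopes, by the
-- recurrence of the Stirling numbers, to the number {m, m - p}. For q, p ≥ 1 it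
-- satisfies the recurrence coefficientwise with respect to the Stirling numbers
-- {m, n + j}, by the Pascal and absorption identities for binomial coefficients.
module Submission where

open import Defs
open import Data.Bool.Base using (if_then_else_; true; false; _∧_)
open import Data.Integer.Base as ℤ using (ℤ; +_; -[1+_]; +[1+_]; _+_; _-_; _*_; -_; _⊖_; _/ℕ_; 0ℤ; 1ℤ)
import Data.Integer.DivMod as ℤ
import Data.Integer.Properties as ℤ
open import Data.Integer.Tactic.RingSolver using (solve-∀)
open import Data.List.Base using (List; []; _∷_; _++_; map; length; filter; foldr; applyUpTo)
open import Data.List.Membership.Propositional using (_∈_; _∉_)
open import Data.List.Membership.Propositional.Properties
open import Data.List.Membership.Propositional.Properties.WithK using (unique∧set⇒bag)
import Data.List.Properties as List
open import Data.List.Relation.Binary.BagAndSetEquality using (∼bag⇒↭)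
open import Data.List.Relation.Binary.Permutation.Propositional using (_↭_; prep; swap; ↭-sym) renaming (refl to ↭-refl; trans to ↭-trans)
open import Data.List.Relation.Binary.Permutation.Propositional.Properties using (↭-length; filter-↭; All-resp-↭)
open import Data.List.Relation.Binary.Sublist.Propositional using (_⊆_; []; _∷_; _∷ʳ_)
open import Data.List.Relation.Binary.Sublist.Propositional.Properties using (All-resp-⊆)
open import Data.List.Relation.Unary.All as All using (All; []; _∷_; all?)
import Data.List.Relation.Unary.All.Properties as All
open import Data.List.Relation.Unary.AllPairs as AllPairs using (AllPairs; []; _∷_; allPairs?)
import Data.List.Relation.Unary.AllPairs.Properties as AllPairs
open import Data.List.Relation.Unary.Any using (here; there)
open import Data.List.Relation.Unary.Unique.Propositional using (Unique)
import Data.List.Relation.Unary.Unique.Propositional.Properties as Unique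
open import Data.Nat.Base as ℕ using (ℕ; zero; suc; _∸_; _≤_; _<_; z≤n; s≤s; _!)
import Data.Nat.Properties as ℕ
import Data.Nat.Tactic.RingSolver as ℕSolver
open import Data.List.Membership.DecPropositional ℕ._≟_ using (_∈?_)
open import Data.Product.Base using (_×_; _,_; proj₁; proj₂; ∃)
open import Data.Sum.Base as Sum using (inj₁; inj₂)
open import Function.Base using (_∘_; id)
open import Function.Bundles using (_⇔_; mk⇔; Equivalence)
open import Relation.Binary.Core using (Rel)
open import Relation.Binary.Definitions using (Symmetric; tri<; tri≈; tri>)
open import Relation.Binary.PropositionalEquality
open import Relation.Nullary using (Dec; ¬_; ¬?; yes; no; does; contradiction)
open import Relation.Nullary.Decidable using (dec-true; dec-false)
open import Relation.Unary using (Pred; Decidable)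
open ≡-Reasoning

-- Counting placements of fixed `k` and `p` directly would mean matching them with placements of
-- other sizes on the smaller board. Instead `total m G` sums an arbitrary function `G` of the two
-- counts over all non-attacking placements. Adding a line of mutually attacking squares then acts
-- linearly on `G`, and the passage from side m to side m + 1 is the composite of two such
-- operators. Only at the end is `G` specialised to an indicator. The free squares of the column are
-- counted against the embedded board alone, those of the diagonal against the embedded board
-- together with the column. In the coordinates (q, p) the terms of the recurrence sit at (q, p), (q
-- - 1, p), (q, p - 1) and (q - 1, p - 1). Hence q = 0, p = 0 and m = 0 are the only boundaries of
-- the induction. The first two are solved from the recurrence itself, which there collapses to that
-- of the Stirling numbers. The Stirling numbers are not linearly independent, but agreement of
-- their coefficients suffices.

+-interchange : ∀ a b c d → a + b + (c + d) ≡ a + c + (b + d)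
+-interchange = solve-∀

-- Sums over sublists

length-filter-map : ∀ {A B : Set} {ℓ} {P : Pred B ℓ} (P? : Decidable P) (h : A → B) xs →
  length (filter P? (map h xs)) ≡ length (filter (P? ∘ h) xs)
length-filter-map P? h []       = refl
length-filter-map P? h (x ∷ xs) with does (P? (h x))
... | true  = cong suc (length-filter-map P? h xs)
... | false = length-filter-map P? h xs

module _ {A : Set} where

  -- Follows the recursion of `subsets`, so that counts over `subsets xs` become sums by induction
  -- on `xs`.
  Σ⊆ : (List A → ℤ) → List A → ℤ
  Σ⊆ f []       = f []
  Σ⊆ f (x ∷ xs) = Σ⊆ f xs + Σ⊆ (f ∘ (x ∷_)) xs

  Σ⊆-cong : ∀ {f g} xs → (∀ P → P ⊆ xs → f P ≡ g P) → Σ⊆ f xs ≡ Σ⊆ g xs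
  Σ⊆-cong []       f≗g = f≗g [] []
  Σ⊆-cong (x ∷ xs) f≗g = cong₂ _+_
    (Σ⊆-cong xs λ P P⊆xs → f≗g P (x ∷ʳ P⊆xs))
    (Σ⊆-cong xs λ P P⊆xs → f≗g (x ∷ P) (refl ∷ P⊆xs))

  Σ⊆-+ : ∀ f g xs → Σ⊆ (λ P → f P + g P) xs ≡ Σ⊆ f xs + Σ⊆ g xs
  Σ⊆-+ f g []       = refl
  Σ⊆-+ f g (x ∷ xs) = trans
    (cong₂ _+_ (Σ⊆-+ f g xs) (Σ⊆-+ (f ∘ (x ∷_)) (g ∘ (x ∷_)) xs))
    (+-interchange (Σ⊆ f xs) (Σ⊆ g xs) (Σ⊆ (f ∘ (x ∷_)) xs) (Σ⊆ (g ∘ (x ∷_)) xs))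

  Σ⊆-* : ∀ c f xs → Σ⊆ (λ P → c * f P) xs ≡ c * Σ⊆ f xs
  Σ⊆-* c f []       = refl
  Σ⊆-* c f (x ∷ xs) = trans (cong₂ _+_ (Σ⊆-* c f xs) (Σ⊆-* c (f ∘ (x ∷_)) xs)) (sym (ℤ.*-distribˡ-+ c _ _))

  -- The part in `ys` is the outer variable: the placement on the remaining squares is fixed while
  -- the sublists of one line are summed.
  Σ⊆-++ : ∀ f xs ys → Σ⊆ f (xs ++ ys) ≡ Σ⊆ (λ Y → Σ⊆ (λ X → f (X ++ Y)) xs) ys
  Σ⊆-++ f []       ys = refl
  Σ⊆-++ f (x ∷ xs) ys = trans
    (cong₂ _+_ (Σ⊆-++ f xs ys) (Σ⊆-++ (f ∘ (x ∷_)) xs ys))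
    (sym (Σ⊆-+ (λ Y → Σ⊆ (λ X → f (X ++ Y)) xs) (λ Y → Σ⊆ (λ X → f (x ∷ X ++ Y)) xs) ys))

  Σ⊆-↭ : ∀ {f xs ys} → (∀ {P Q} → P ↭ Q → f P ≡ f Q) → xs ↭ ys → Σ⊆ f xs ≡ Σ⊆ f ys
  Σ⊆-↭ f-↭ ↭-refl = refl
  Σ⊆-↭ f-↭ (prep x xs↭ys) = cong₂ _+_ (Σ⊆-↭ f-↭ xs↭ys) (Σ⊆-↭ (f-↭ ∘ prep x) xs↭ys)
  Σ⊆-↭ {f} {_ ∷ _ ∷ xs} {_ ∷ _ ∷ ys} f-↭ (swap x y xs↭ys) = begin
    Σ⊆ f xs + Σ⊆ (f ∘ (y ∷_)) xs + (Σ⊆ (f ∘ (x ∷_)) xs + Σ⊆ (λ P → f (x ∷ y ∷ P)) xs)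
      -- Sublists containing both swapped elements list them in the other order, so here the
      -- invariance of `f` itself is used.
      ≡⟨ cong (λ z → Σ⊆ f xs + Σ⊆ (f ∘ (y ∷_)) xs + (Σ⊆ (f ∘ (x ∷_)) xs + z)) (Σ⊆-cong xs λ P _ → f-↭ (swap x y ↭-refl)) ⟩
    Σ⊆ f xs + Σ⊆ (f ∘ (y ∷_)) xs + (Σ⊆ (f ∘ (x ∷_)) xs + Σ⊆ (λ P → f (y ∷ x ∷ P)) xs)
      ≡⟨ +-interchange (Σ⊆ f xs) (Σ⊆ (f ∘ (y ∷_)) xs) (Σ⊆ (f ∘ (x ∷_)) xs) (Σ⊆ (λ P → f (y ∷ x ∷ P)) xs) ⟩
    Σ⊆ f xs + Σ⊆ (f ∘ (x ∷_)) xs + (Σ⊆ (f ∘ (y ∷_)) xs + Σ⊆ (λ P → f (y ∷ x ∷ P)) xs)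
      ≡⟨ cong₂ _+_ (cong₂ _+_ (Σ⊆-↭ f-↭ xs↭ys) (Σ⊆-↭ (f-↭ ∘ prep x) xs↭ys))
                   (cong₂ _+_ (Σ⊆-↭ (f-↭ ∘ prep y) xs↭ys) (Σ⊆-↭ (f-↭ ∘ prep y ∘ prep x) xs↭ys)) ⟩
    Σ⊆ f ys + Σ⊆ (f ∘ (x ∷_)) ys + (Σ⊆ (f ∘ (y ∷_)) ys + Σ⊆ (λ P → f (y ∷ x ∷ P)) ys) ∎
  Σ⊆-↭ f-↭ (↭-trans xs↭ys ys↭zs) = trans (Σ⊆-↭ f-↭ xs↭ys) (Σ⊆-↭ f-↭ ys↭zs)

  -- Every nonempty sublist has its head in `xs`. This serves both to exclude a second piece on a
  -- line and to discard extensions of a placement that already attacks itself.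
  Σ⊆-vanish : ∀ {f} xs → (∀ y P → y ∈ xs → f (y ∷ P) ≡ 0ℤ) → Σ⊆ f xs ≡ f []
  Σ⊆-vanish []       _   = refl
  Σ⊆-vanish {f} (x ∷ xs) f≡0 = trans
    (cong₂ _+_ (Σ⊆-vanish xs λ y P y∈xs → f≡0 y P (there y∈xs))
      (trans (Σ⊆-vanish xs λ y P y∈xs → f≡0 x (y ∷ P) (here refl)) (f≡0 x [] (here refl))))
    (ℤ.+-identityʳ (f []))

  length-filter-subsets : ∀ {ℓ} {P : Pred (List A) ℓ} (P? : Decidable P) xs →
    + length (filter P? (subsets xs)) ≡ Σ⊆ (λ X → if does (P? X) then 1ℤ else 0ℤ) xs
  length-filter-subsets P? [] with does (P? [])
  ... | true  = refl
  ... | false = refl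
  length-filter-subsets P? (x ∷ xs) = begin
    + length (filter P? (subsets xs ++ map (x ∷_) (subsets xs)))
      ≡⟨ cong (+_ ∘ length) (List.filter-++ P? (subsets xs) (map (x ∷_) (subsets xs))) ⟩
    + length (filter P? (subsets xs) ++ filter P? (map (x ∷_) (subsets xs)))
      ≡⟨ cong +_ (List.length-++ (filter P? (subsets xs))) ⟩
    + (length (filter P? (subsets xs)) ℕ.+ length (filter P? (map (x ∷_) (subsets xs))))
      ≡⟨ ℤ.pos-+ (length (filter P? (subsets xs))) _ ⟩
    + length (filter P? (subsets xs)) + + length (filter P? (map (x ∷_) (subsets xs)))
      ≡⟨ cong₂ _+_ (length-filter-subsets P? xs)
           (trans (cong +_ (length-filter-map P? (x ∷_) (subsets xs))) (length-filter-subsets (λ X → P? (x ∷ X)) xs)) ⟩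
    Σ⊆ (λ X → if does (P? X) then 1ℤ else 0ℤ) xs + Σ⊆ (λ X → if does (P? (x ∷ X)) then 1ℤ else 0ℤ) xs ∎

  AllPairs-resp-⊆ : ∀ {ℓ} {R : Rel A ℓ} {xs ys} → xs ⊆ ys → AllPairs R ys → AllPairs R xs
  AllPairs-resp-⊆ []              []         = []
  AllPairs-resp-⊆ (_ ∷ʳ xs⊆ys)    (_ ∷ rs)   = AllPairs-resp-⊆ xs⊆ys rs
  AllPairs-resp-⊆ (refl ∷ xs⊆ys)  (r ∷ rs)   = All-resp-⊆ xs⊆ys r ∷ AllPairs-resp-⊆ xs⊆ys rs

  AllPairs-resp-↭ : ∀ {ℓ} {R : Rel A ℓ} → Symmetric R → ∀ {xs ys} → xs ↭ ys → AllPairs R xs → AllPairs R ys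
  AllPairs-resp-↭ R-sym ↭-refl          rs                      = rs
  AllPairs-resp-↭ R-sym (prep x p)      (r ∷ rs)                = All-resp-↭ p r ∷ AllPairs-resp-↭ R-sym p rs
  AllPairs-resp-↭ R-sym (swap x y p)    ((xy ∷ r) ∷ r′ ∷ rs)    = (R-sym xy ∷ All-resp-↭ p r′) ∷ All-resp-↭ p r ∷ AllPairs-resp-↭ R-sym p rs
  AllPairs-resp-↭ R-sym (↭-trans p q)   rs                      = AllPairs-resp-↭ R-sym q (AllPairs-resp-↭ R-sym p rs)

  length-filter-¬? : ∀ {ℓ} {P : Pred A ℓ} (P? : Decidable P) xs → length (filter (¬? ∘ P?) xs) ℕ.+ length (filter P? xs) ≡ length xs
  length-filter-¬? P? []       = refl
  length-filter-¬? P? (x ∷ xs) with does (P? x)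
  ... | true  = trans (ℕ.+-suc _ _) (cong suc (length-filter-¬? P? xs))
  ... | false = cong suc (length-filter-¬? P? xs)

  unique∧set⇒↭ : ∀ {xs ys : List A} → Unique xs → Unique ys → (∀ {x} → x ∈ xs → x ∈ ys) → (∀ {x} → x ∈ ys → x ∈ xs) → xs ↭ ys
  unique∧set⇒↭ xs! ys! to from = ∼bag⇒↭ (unique∧set⇒bag xs! ys! (mk⇔ to from))

Σ⊆-map : ∀ {A B : Set} (f : List B → ℤ) (h : A → B) xs → Σ⊆ f (map h xs) ≡ Σ⊆ (f ∘ map h) xs
Σ⊆-map f h []       = refl
Σ⊆-map f h (x ∷ xs) = cong₂ _+_ (Σ⊆-map f h xs) (Σ⊆-map (f ∘ (h x ∷_)) h xs)

-- `V` and the part of `U` inside `V` are duplicate-free with the same elements, hence of equal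
-- length. Here the distinctness of occupied columns or diagonals turns into a count of free
-- squares.
length-filter-∉ : ∀ {U V} → Unique U → Unique V → (∀ {v} → v ∈ V → v ∈ U) →
  length (filter (λ u → ¬? (u ∈? V)) U) ℕ.+ length V ≡ length U
length-filter-∉ {U} {V} U! V! V⊆U = trans
  (cong (length (filter (λ u → ¬? (u ∈? V)) U) ℕ.+_) (↭-length V↭))
  (length-filter-¬? (_∈? V) U)
  where
  V↭ : V ↭ filter (_∈? V) U
  V↭ = unique∧set⇒↭ V! (Unique.filter⁺ (_∈? V) U!) (λ v∈V → ∈-filter⁺ (_∈? V) (V⊆U v∈V) v∈V) (proj₂ ∘ ∈-filter⁻ (_∈? V) {xs = U})

-- Placing further pieces on a line of mutually attacking squares

Attacks-sym : ∀ {s t} → Attacks s t → Attacks t s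
Attacks-sym (s≢t , aligned) = s≢t ∘ sym , Sum.map sym sym aligned

NonAttacking : List Square → Set
NonAttacking = AllPairs (λ s t → ¬ Attacks s t)

nonAttacking? : Decidable NonAttacking
nonAttacking? = allPairs? (λ s t → ¬? (attacks? s t))

below : List Square → ℕ
below P = length (filter belowDiagonal? P)

weight : (ℕ → ℕ → ℤ) → List Square → ℤ
weight G P = if does (nonAttacking? P) then G (length P) (below P) else 0ℤ

weight-valid : ∀ G P → NonAttacking P → weight G P ≡ G (length P) (below P)
weight-valid G P v = cong (λ b → if b then G (length P) (below P) else 0ℤ) (dec-true (nonAttacking? P) v)

weight-invalid : ∀ G P → ¬ NonAttacking P → weight G P ≡ 0ℤ
weight-invalid G P ¬v = cong (λ b → if b then G (length P) (below P) else 0ℤ) (dec-false (nonAttacking? P) ¬v)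

weight-≡ : ∀ G H P Q → (NonAttacking P → NonAttacking Q) → (NonAttacking Q → NonAttacking P) →
  (NonAttacking P → G (length P) (below P) ≡ H (length Q) (below Q)) → weight G P ≡ weight H Q
weight-≡ G H P Q to from eq with nonAttacking? P
... | yes v = trans (eq v) (sym (weight-valid H Q (to v)))
... | no ¬v = sym (weight-invalid H Q (¬v ∘ from))

weight-↭ : ∀ G {P Q} → P ↭ Q → weight G P ≡ weight G Q
weight-↭ G {P} {Q} P↭Q = weight-≡ G G P Q
  (AllPairs-resp-↭ (_∘ Attacks-sym) P↭Q) (AllPairs-resp-↭ (_∘ Attacks-sym) (↭-sym P↭Q))
  (λ _ → cong₂ G (↭-length P↭Q) (↭-length (filter-↭ belowDiagonal? P↭Q)))

Free : List Square → Square → Set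
Free Y x = All (λ t → ¬ Attacks x t) Y

free? : ∀ Y → Decidable (Free Y)
free? Y x = all? (λ t → ¬? (attacks? x t)) Y

-- At most one square of `L` can be occupied: the empty choice gives the first summand, each free
-- square one copy of the second. The number `b` is what a piece on the line adds to the count below
-- the diagonal: 0 for the main diagonal, 1 for the column.
Σ⊆-line : ∀ G b Y L → AllPairs Attacks L → NonAttacking Y → All (λ x → below (x ∷ Y) ≡ b ℕ.+ below Y) L →
  Σ⊆ (λ X → weight G (X ++ Y)) L
    ≡ G (length Y) (below Y) + + length (filter (free? Y) L) * G (suc (length Y)) (b ℕ.+ below Y)
Σ⊆-line G b Y [] _ v _ = trans (weight-valid G Y v) (lemma (G (length Y) (below Y)) (G (suc (length Y)) (b ℕ.+ below Y)))
  where
  lemma : ∀ x y → x ≡ x + 0ℤ * y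
  lemma = solve-∀
Σ⊆-line G b Y (x ∷ L) (x-L ∷ L-L) v (bx ∷ bL) = trans (cong₂ _+_ (Σ⊆-line G b Y L L-L v bL) through-x) (count (free? Y x))
  where
  through-x : Σ⊆ (λ X → weight G (x ∷ X ++ Y)) L ≡ weight G (x ∷ Y)
  through-x = Σ⊆-vanish L λ y P y∈L → weight-invalid G (x ∷ y ∷ P ++ Y) λ { ((¬x-y ∷ _) ∷ _) → ¬x-y (All.lookup x-L y∈L) }
  g = G (length Y) (below Y)
  h = G (suc (length Y)) (b ℕ.+ below Y)
  N = length (filter (free? Y) L)
  lemma : ∀ g N h → g + N * h + h ≡ g + (1ℤ + N) * h
  lemma = solve-∀
  count : Dec (Free Y x) → g + + N * h + weight G (x ∷ Y) ≡ g + + length (filter (free? Y) (x ∷ L)) * h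
  count (yes x-free) = begin
    g + + N * h + weight G (x ∷ Y)                   ≡⟨ cong (λ z → g + + N * h + z) (trans (weight-valid G (x ∷ Y) (x-free ∷ v)) (cong (G (suc (length Y))) bx)) ⟩
    g + + N * h + h                                  ≡⟨ lemma g (+ N) h ⟩
    g + + suc N * h                                  ≡⟨ cong (λ z → g + + length z * h) (List.filter-accept (free? Y) x-free) ⟨
    g + + length (filter (free? Y) (x ∷ L)) * h      ∎
  count (no ¬free) = begin
    g + + N * h + weight G (x ∷ Y)                   ≡⟨ cong (λ z → g + + N * h + z) (weight-invalid G (x ∷ Y) λ { (f ∷ _) → ¬free f }) ⟩
    g + + N * h + 0ℤ                                 ≡⟨ ℤ.+-identityʳ (g + + N * h) ⟩
    g + + N * h                                      ≡⟨ cong (λ z → g + + length z * h) (List.filter-reject (free? Y) ¬free) ⟨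
    g + + length (filter (free? Y) (x ∷ L)) * h      ∎

-- For self-attacking `Y` both sides are zero, so the free squares are counted only for valid
-- placements. The result is again a `weight`, which allows a second line to be summed in the same
-- way.
Σ⊆-line-weight : ∀ G b (c : ℕ → ℕ → ℤ) Y L → AllPairs Attacks L → All (λ x → below (x ∷ Y) ≡ b ℕ.+ below Y) L →
  (NonAttacking Y → + length (filter (free? Y) L) ≡ c (length Y) (below Y)) →
  Σ⊆ (λ X → weight G (X ++ Y)) L ≡ weight (λ k p → G k p + c k p * G (suc k) (b ℕ.+ p)) Y
Σ⊆-line-weight G b c Y L L-L bL free-count = cases (nonAttacking? Y)
  where
  H : ℕ → ℕ → ℤ
  H k p = G k p + c k p * G (suc k) (b ℕ.+ p)
  suffix : ∀ X → NonAttacking (X ++ Y) → NonAttacking Y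
  suffix []      v       = v
  suffix (_ ∷ X) (_ ∷ v) = suffix X v
  cases : Dec (NonAttacking Y) → Σ⊆ (λ X → weight G (X ++ Y)) L ≡ weight H Y
  cases (yes v) = begin
    Σ⊆ (λ X → weight G (X ++ Y)) L ≡⟨ Σ⊆-line G b Y L L-L v bL ⟩
    G (length Y) (below Y) + + length (filter (free? Y) L) * G (suc (length Y)) (b ℕ.+ below Y)
      ≡⟨ cong (λ z → G (length Y) (below Y) + z * G (suc (length Y)) (b ℕ.+ below Y)) (free-count v) ⟩
    H (length Y) (below Y)         ≡⟨ weight-valid H Y v ⟨
    weight H Y                     ∎
  cases (no ¬v) = begin
    Σ⊆ (λ X → weight G (X ++ Y)) L ≡⟨ Σ⊆-vanish L (λ y P _ → weight-invalid G (y ∷ P ++ Y) (¬v ∘ suffix (y ∷ P))) ⟩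
    weight G Y                     ≡⟨ weight-invalid G Y ¬v ⟩
    0ℤ                             ≡⟨ weight-invalid H Y ¬v ⟨
    weight H Y                     ∎

-- Decomposition of the board

range : ℕ → List ℕ
range = applyUpTo suc

range-unique : ∀ m → Unique (range m)
range-unique m = Unique.applyUpTo⁺₁ suc m λ i<j _ eq → ℕ.<⇒≢ i<j (ℕ.suc-injective eq)

∈-range⁺ : ∀ {m i} → 1 ≤ i → i ≤ m → i ∈ range m
∈-range⁺ {i = suc _} _ i≤m = ∈-applyUpTo⁺ suc i≤m

∈-range⁻ : ∀ {m i} → i ∈ range m → 1 ≤ i × i ≤ m
∈-range⁻ i∈ with _ , i<m , refl ← ∈-applyUpTo⁻ suc i∈ = s≤s z≤n , i<m

∈-board⁺ : ∀ {m i j} → 1 ≤ i → i ≤ m → 1 ≤ j → j ≤ m → (i , j) ∈ board m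
∈-board⁺ 1≤i i≤m 1≤j j≤m = ∈-cartesianProduct⁺ (∈-range⁺ 1≤i i≤m) (∈-range⁺ 1≤j j≤m)

∈-board⁻ : ∀ {m i j} → (i , j) ∈ board m → (1 ≤ i × i ≤ m) × (1 ≤ j × j ≤ m)
∈-board⁻ {m} s∈ with i∈ , j∈ ← ∈-cartesianProduct⁻ (range m) (range m) s∈ = ∈-range⁻ i∈ , ∈-range⁻ j∈

board-unique : ∀ m → Unique (board m)
board-unique m = Unique.cartesianProduct⁺ (range-unique m) (range-unique m)

aligned⁻ : ∀ s t → + column s - + row s ≡ + column t - + row t → column s ℕ.+ row t ≡ column t ℕ.+ row s
aligned⁻ (c , r) (c′ , r′) eq = ℤ.+-injective (begin
  + (c ℕ.+ r′)                   ≡⟨ ℤ.pos-+ c r′ ⟩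
  + c + + r′                     ≡⟨ lemma₁ (+ c) (+ r) (+ r′) ⟩
  + c - + r + (+ r + + r′)       ≡⟨ cong (_+ (+ r + + r′)) eq ⟩
  + c′ - + r′ + (+ r + + r′)     ≡⟨ lemma₂ (+ c′) (+ r) (+ r′) ⟩
  + c′ + + r                     ≡⟨ ℤ.pos-+ c′ r ⟨
  + (c′ ℕ.+ r)                   ∎)
  where
  lemma₁ : ∀ c r r′ → c + r′ ≡ c - r + (r + r′)
  lemma₁ = solve-∀
  lemma₂ : ∀ c r r′ → c - r′ + (r + r′) ≡ c + r
  lemma₂ = solve-∀

aligned⁺ : ∀ s t → column s ℕ.+ row t ≡ column t ℕ.+ row s → + column s - + row s ≡ + column t - + row t
aligned⁺ (c , r) (c′ , r′) eq = begin
  + c - + r                          ≡⟨ lemma₁ (+ c) (+ r) (+ r′) ⟩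
  + c + + r′ - (+ r + + r′)          ≡⟨ cong (_- (+ r + + r′)) (trans (sym (ℤ.pos-+ c r′)) (trans (cong +_ eq) (ℤ.pos-+ c′ r))) ⟩
  + c′ + + r - (+ r + + r′)          ≡⟨ lemma₂ (+ c′) (+ r) (+ r′) ⟩
  + c′ - + r′                        ∎
  where
  lemma₁ : ∀ c r r′ → c - r ≡ c + r′ - (r + r′)
  lemma₁ = solve-∀
  lemma₂ : ∀ c r r′ → c + r - (r + r′) ≡ c - r′
  lemma₂ = solve-∀

raise : ℕ → ℕ → ℕ
raise i j = if does (i ℕ.≤? j) then suc j else j

raise-upper : ∀ {i j} → i ≤ j → raise i j ≡ suc j
raise-upper {i} {j} i≤j = cong (λ b → if b then suc j else j) (dec-true (i ℕ.≤? j) i≤j)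

raise-lower : ∀ {i j} → j < i → raise i j ≡ j
raise-lower {i} {j} j<i = cong (λ b → if b then suc j else j) (dec-false (i ℕ.≤? j) (ℕ.<⇒≱ j<i))

lift : Square → Square
lift (i , j) = i , raise i j

lift-upper : ∀ {i j} → i ≤ j → lift (i , j) ≡ (i , suc j)
lift-upper {i} i≤j = cong (i ,_) (raise-upper i≤j)

lift-lower : ∀ {i j} → j < i → lift (i , j) ≡ (i , j)
lift-lower {i} j<i = cong (i ,_) (raise-lower j<i)

lift-injective : ∀ {s t} → lift s ≡ lift t → s ≡ t
lift-injective {a , b} {c , d} eq with ℕ.≤-<-connex a b | ℕ.≤-<-connex c d
... | inj₁ a≤b | inj₁ c≤d with refl ← trans (sym (lift-upper a≤b)) (trans eq (lift-upper c≤d)) = refl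
... | inj₁ a≤b | inj₂ d<c with refl ← trans (sym (lift-upper a≤b)) (trans eq (lift-lower d<c)) = contradiction (ℕ.≤-trans d<c a≤b) (ℕ.<⇒≱ (ℕ.m≤n⇒m≤1+n ℕ.≤-refl))
... | inj₂ b<a | inj₁ c≤d with refl ← trans (sym (lift-lower b<a)) (trans eq (lift-upper c≤d)) = contradiction (ℕ.≤-trans b<a c≤d) (ℕ.<⇒≱ (ℕ.m≤n⇒m≤1+n ℕ.≤-refl))
... | inj₂ b<a | inj₂ d<c with refl ← trans (sym (lift-lower b<a)) (trans eq (lift-lower d<c)) = refl

-- Two squares on the same side are raised equally. A square on or above the main diagonal and one
-- strictly below it never share a diagonal, and raising the former only widens the gap.
lift-diagonal : ∀ s t → (column s ℕ.+ row t ≡ column t ℕ.+ row s) ⇔ (column s ℕ.+ row (lift t) ≡ column t ℕ.+ row (lift s))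
lift-diagonal (a , b) (c , d) with ℕ.≤-<-connex a b | ℕ.≤-<-connex c d
... | inj₁ a≤b | inj₁ c≤d rewrite raise-upper a≤b | raise-upper c≤d | ℕ.+-suc a d | ℕ.+-suc c b = mk⇔ (cong suc) ℕ.suc-injective
... | inj₁ a≤b | inj₂ d<c rewrite raise-upper a≤b | raise-lower d<c = mk⇔
  (λ eq → contradiction eq (ℕ.<⇒≢ lt)) (λ eq → contradiction eq (ℕ.<⇒≢ (ℕ.<-≤-trans lt (ℕ.+-monoʳ-≤ c (ℕ.n≤1+n b)))))
  where
  lt : a ℕ.+ d < c ℕ.+ b
  lt = subst (_< c ℕ.+ b) (ℕ.+-comm d a) (ℕ.+-mono-<-≤ d<c a≤b)
... | inj₂ b<a | inj₁ c≤d rewrite raise-lower b<a | raise-upper c≤d = mk⇔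
  (λ eq → contradiction (sym eq) (ℕ.<⇒≢ lt)) (λ eq → contradiction (sym eq) (ℕ.<⇒≢ (ℕ.<-≤-trans lt (ℕ.+-monoʳ-≤ a (ℕ.n≤1+n d)))))
  where
  lt : c ℕ.+ b < a ℕ.+ d
  lt = subst (_< a ℕ.+ d) (ℕ.+-comm b c) (ℕ.+-mono-<-≤ b<a c≤d)
... | inj₂ b<a | inj₂ d<c rewrite raise-lower b<a | raise-lower d<c = mk⇔ id id

lift-attacks⁺ : ∀ {s t} → Attacks s t → Attacks (lift s) (lift t)
lift-attacks⁺ {s} {t} (s≢t , aligned) = s≢t ∘ lift-injective , Sum.map₂ (aligned⁺ (lift s) (lift t) ∘ Equivalence.to (lift-diagonal s t) ∘ aligned⁻ s t) aligned

lift-attacks⁻ : ∀ {s t} → Attacks (lift s) (lift t) → Attacks s t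
lift-attacks⁻ {s} {t} (s≢t , aligned) = s≢t ∘ cong lift , Sum.map₂ (aligned⁺ s t ∘ Equivalence.from (lift-diagonal s t) ∘ aligned⁻ (lift s) (lift t)) aligned

lift-below⁻ : ∀ {s} → BelowDiagonal (lift s) → BelowDiagonal s
lift-below⁻ {i , j} lt with ℕ.≤-<-connex i j
... | inj₁ i≤j rewrite raise-upper i≤j = ℕ.<-trans (ℕ.n<1+n j) lt
... | inj₂ j<i = j<i

lift-below⁺ : ∀ {s} → BelowDiagonal s → BelowDiagonal (lift s)
lift-below⁺ {i , j} j<i rewrite raise-lower j<i = j<i

weight-lift : ∀ G P → weight G (map lift P) ≡ weight G P
weight-lift G P = weight-≡ G G (map lift P) P
  (λ v → AllPairs.map (_∘ lift-attacks⁺) (AllPairs.map⁻ v))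
  (λ v → AllPairs.map⁺ (AllPairs.map (_∘ lift-attacks⁻) v))
  (λ _ → cong₂ G (List.length-map lift P)
    (trans (length-filter-map belowDiagonal? lift P)
      (cong length (List.filter-≐ (belowDiagonal? ∘ lift) belowDiagonal? (lift-below⁻ , lift-below⁺) P))))

diagonal : ℕ → List Square
diagonal m = map (λ i → i , i) (range m)

lastColumn : ℕ → List Square
lastColumn m = map (suc m ,_) (range m)

∈-diagonal⁻ : ∀ {m s} → s ∈ diagonal m → column s ≡ row s × 1 ≤ column s × column s ≤ m
∈-diagonal⁻ s∈ with _ , i∈ , refl ← ∈-map⁻ _ s∈ = refl , ∈-range⁻ i∈

∈-lastColumn⁻ : ∀ {m s} → s ∈ lastColumn m → column s ≡ suc m × 1 ≤ row s × row s ≤ m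
∈-lastColumn⁻ s∈ with _ , j∈ , refl ← ∈-map⁻ _ s∈ = refl , ∈-range⁻ j∈

∈-lift⁻ : ∀ {m s} → s ∈ map lift (board m) → (1 ≤ column s × column s ≤ m) × (1 ≤ row s × row s ≤ suc m) × column s ≢ row s
∈-lift⁻ {m} s∈ with (i , j) , ij∈ , refl ← ∈-map⁻ lift s∈ with (1≤i , i≤m) , (1≤j , j≤m) ← ∈-board⁻ {m} ij∈ with ℕ.≤-<-connex i j
... | inj₁ i≤j rewrite raise-upper i≤j = (1≤i , i≤m) , (s≤s z≤n , s≤s j≤m) , ℕ.<⇒≢ (s≤s i≤j)
... | inj₂ j<i rewrite raise-lower j<i = (1≤i , i≤m) , (1≤j , ℕ.m≤n⇒m≤1+n j≤m) , ℕ.>⇒≢ j<i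

rest : ℕ → List Square
rest m = lastColumn m ++ map lift (board m)

∈-rest⁻ : ∀ {m s} → s ∈ rest m → (1 ≤ column s × column s ≤ suc m) × (1 ≤ row s × row s ≤ suc m) × column s ≢ row s
∈-rest⁻ {m} s∈ with ∈-++⁻ (lastColumn m) s∈
... | inj₁ s∈L with refl , 1≤j , j≤m ← ∈-lastColumn⁻ {m} s∈L = (s≤s z≤n , ℕ.≤-refl) , (1≤j , ℕ.m≤n⇒m≤1+n j≤m) , ℕ.>⇒≢ (s≤s j≤m)
... | inj₂ s∈B with (1≤i , i≤m) , j-bounds , i≢j ← ∈-lift⁻ {m} s∈B = (1≤i , ℕ.m≤n⇒m≤1+n i≤m) , j-bounds , i≢j

lift-board-unique : ∀ m → Unique (map lift (board m))
lift-board-unique m = Unique.map⁺ lift-injective (board-unique m)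

rest-unique : ∀ m → Unique (rest m)
rest-unique m = Unique.++⁺ (Unique.map⁺ (cong proj₂) (range-unique m)) (lift-board-unique m)
  λ { (s∈L , s∈B) → ℕ.<⇒≢ (s≤s (proj₂ (proj₁ (∈-lift⁻ {m} s∈B)))) (proj₁ (∈-lastColumn⁻ {m} s∈L)) }

-- The two lists order the squares differently, whence a permutation; both are duplicate-free, so it
-- suffices to compare their elements.
board-decomposition : ∀ m → board (suc m) ↭ diagonal (suc m) ++ rest m
board-decomposition m = unique∧set⇒↭ (board-unique (suc m))
  (Unique.++⁺ (Unique.map⁺ (cong proj₁) (range-unique (suc m))) (rest-unique m)
    λ { (s∈D , s∈R) → proj₂ (proj₂ (∈-rest⁻ {m} s∈R)) (proj₁ (∈-diagonal⁻ {suc m} s∈D)) })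
  to from
  where
  upper : ∀ {i j} → 1 ≤ i → i < j → j ≤ suc m → (i , j) ∈ map lift (board m)
  -- The preimage lies one row lower, and i < j + 1 says exactly that it is still on or above the
  -- main diagonal.
  upper {j = suc j} 1≤i (s≤s i≤j) (s≤s j≤m) = subst (_∈ map lift (board m)) (lift-upper i≤j)
    (∈-map⁺ lift (∈-board⁺ 1≤i (ℕ.≤-trans i≤j j≤m) (ℕ.≤-trans 1≤i i≤j) j≤m))
  lower : ∀ {i j} → 1 ≤ j → j < i → i ≤ suc m → (i , j) ∈ rest m
  lower 1≤j j<i i≤sm with ℕ.m≤n⇒m<n∨m≡n i≤sm
  ... | inj₂ refl      = ∈-++⁺ˡ (∈-map⁺ _ (∈-range⁺ 1≤j (ℕ.s≤s⁻¹ j<i)))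
  ... | inj₁ (s≤s i≤m) = ∈-++⁺ʳ (lastColumn m) (subst (_∈ map lift (board m)) (lift-lower j<i)
    (∈-map⁺ lift (∈-board⁺ (ℕ.≤-trans 1≤j (ℕ.<⇒≤ j<i)) i≤m 1≤j (ℕ.≤-trans (ℕ.<⇒≤ j<i) i≤m))))
  to : ∀ {s} → s ∈ board (suc m) → s ∈ diagonal (suc m) ++ rest m
  to {i , j} s∈ with (1≤i , i≤m) , (1≤j , j≤m) ← ∈-board⁻ {suc m} s∈ with ℕ.<-cmp i j
  ... | tri< i<j _ _  = ∈-++⁺ʳ (diagonal (suc m)) (∈-++⁺ʳ (lastColumn m) (upper 1≤i i<j j≤m))
  ... | tri≈ _ refl _ = ∈-++⁺ˡ (∈-map⁺ _ (∈-range⁺ 1≤i i≤m))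
  ... | tri> _ _ j<i  = ∈-++⁺ʳ (diagonal (suc m)) (lower 1≤j j<i i≤m)
  from : ∀ {s} → s ∈ diagonal (suc m) ++ rest m → s ∈ board (suc m)
  from s∈ with ∈-++⁻ (diagonal (suc m)) s∈
  ... | inj₁ s∈D with refl , 1≤i , i≤m ← ∈-diagonal⁻ {suc m} s∈D = ∈-board⁺ 1≤i i≤m 1≤i i≤m
  ... | inj₂ s∈R with (1≤i , i≤m) , (1≤j , j≤m) , _ ← ∈-rest⁻ {m} s∈R = ∈-board⁺ 1≤i i≤m 1≤j j≤m

-- Counting the free squares of the two lines

length-filter-cong : ∀ {A : Set} {ℓ ℓ′} {P : Pred A ℓ} {Q : Pred A ℓ′} (P? : Decidable P) (Q? : Decidable Q) xs →
  All (λ x → P x ⇔ Q x) xs → length (filter P? xs) ≡ length (filter Q? xs)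
length-filter-cong P? Q? []       []             = refl
length-filter-cong P? Q? (x ∷ xs) (P⇔Q ∷ Ps⇔Qs) with P? x
... | yes Px = trans (cong suc (length-filter-cong P? Q? xs Ps⇔Qs)) (cong length (sym (List.filter-accept Q? (Equivalence.to P⇔Q Px))))
... | no ¬Px = trans (length-filter-cong P? Q? xs Ps⇔Qs) (cong length (sym (List.filter-reject Q? (¬Px ∘ Equivalence.from P⇔Q))))

AllPairs-refine : ∀ {A : Set} {ℓ ℓ′ ℓ″} {P : Pred A ℓ} {R : Rel A ℓ′} {S : Rel A ℓ″} {xs} →
  (∀ {x y} → P x → P y → R x y → S x y) → All P xs → AllPairs R xs → AllPairs S xs
AllPairs-refine f []       []       = []
AllPairs-refine f (p ∷ ps) (r ∷ rs) = All.map (λ { (py , rxy) → f p py rxy }) (All.zip (ps , r)) ∷ AllPairs-refine f ps rs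

+-difference : ∀ {a b c} → a ℕ.+ b ≡ c → + a ≡ + c - + b
+-difference {a} {b} refl = trans (lemma (+ a) (+ b)) (cong (_- + b) (sym (ℤ.pos-+ a b)))
  where
  lemma : ∀ a b → a ≡ a + b - b
  lemma = solve-∀

-- No piece of `Y` is on the main diagonal, so it attacks diagonal squares only along its column,
-- and the columns of `Y` are distinct. A piece in column m + 1 blocks a diagonal square too.
diagonal-free : ∀ m Y → Y ⊆ rest m → NonAttacking Y →
  + length (filter (free? Y) (diagonal (suc m))) ≡ + suc m - + length Y
diagonal-free m Y Y⊆ v = +-difference (begin
  length (filter (free? Y) (diagonal (suc m))) ℕ.+ length Y
    ≡⟨ cong₂ ℕ._+_ (length-filter-map (free? Y) (λ i → i , i) (range (suc m))) (sym (List.length-map column Y)) ⟩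
  length (filter (λ i → free? Y (i , i)) (range (suc m))) ℕ.+ length V
    ≡⟨ cong (ℕ._+ length V) (length-filter-cong (λ i → free? Y (i , i)) (λ i → ¬? (i ∈? V)) (range (suc m)) (All.tabulate λ {i} _ → mk⇔ (to i) (from i))) ⟩
  length (filter (λ i → ¬? (i ∈? V)) (range (suc m))) ℕ.+ length V
    ≡⟨ length-filter-∉ (range-unique (suc m)) V-unique V⊆range ⟩
  length (range (suc m))
    ≡⟨ List.length-applyUpTo suc (suc m) ⟩
  suc m ∎)
  where
  V = map column Y
  inRest : All (_∈ rest m) Y
  inRest = All-resp-⊆ Y⊆ (All.tabulate id)
  off-diagonal : ∀ {t} → t ∈ Y → column t ≢ row t
  off-diagonal t∈Y = proj₂ (proj₂ (∈-rest⁻ {m} (All.lookup inRest t∈Y)))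
  V-unique : Unique V
  V-unique = AllPairs.map⁺ (AllPairs.map (λ { (s≢t , ¬attack) c≡c → ¬attack (s≢t , inj₁ c≡c) })
    (AllPairs.zip (AllPairs-resp-⊆ Y⊆ (rest-unique m) , v)))
  V⊆range : ∀ {i} → i ∈ V → i ∈ range (suc m)
  V⊆range i∈V with t , t∈Y , refl ← ∈-map⁻ column i∈V with (1≤c , c≤) , _ ← ∈-rest⁻ {m} (All.lookup inRest t∈Y) = ∈-range⁺ 1≤c c≤
  to : ∀ i → Free Y (i , i) → i ∉ V
  to i free i∈V with t , t∈Y , refl ← ∈-map⁻ column i∈V =
    All.lookup free t∈Y ((λ eq → off-diagonal t∈Y (trans (sym (cong proj₁ eq)) (cong proj₂ eq))) , inj₁ refl)
  from : ∀ i → i ∉ V → Free Y (i , i)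
  from i i∉V = All.tabulate ¬attack
    where
    ¬attack : ∀ {t} → t ∈ Y → ¬ Attacks (i , i) t
    ¬attack     t∈Y (_ , inj₁ refl) = i∉V (∈-map⁺ column t∈Y)
    ¬attack {t} t∈Y (_ , inj₂ eq)   = off-diagonal t∈Y
      (sym (ℕ.+-cancelˡ-≡ i _ _ (trans (aligned⁻ (i , i) t eq) (ℕ.+-comm (column t) i))))

-- The row in which the diagonal of t meets column suc m.
exitRow : ℕ → Square → ℕ
exitRow m t = row t ℕ.+ (suc m ∸ column t)

exitRow-spec : ∀ m t → column t ≤ m → column t ℕ.+ exitRow m t ≡ suc m ℕ.+ row t
exitRow-spec m t c≤m = begin
  column t ℕ.+ (row t ℕ.+ (suc m ∸ column t)) ≡⟨ cong (column t ℕ.+_) (ℕ.+-comm (row t) _) ⟩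
  column t ℕ.+ ((suc m ∸ column t) ℕ.+ row t) ≡⟨ ℕ.+-assoc (column t) _ _ ⟨
  column t ℕ.+ (suc m ∸ column t) ℕ.+ row t   ≡⟨ cong (ℕ._+ row t) (ℕ.m+[n∸m]≡n (ℕ.m≤n⇒m≤1+n c≤m)) ⟩
  suc m ℕ.+ row t                             ∎

-- All columns of `Z` are at most m, so attacks come only along diagonals. The pieces below the main
-- diagonal are those whose diagonal meets column m + 1 in one of the rows 1 to m, and non-attacking
-- pieces have distinct exit rows.
lastColumn-free : ∀ m Z → Z ⊆ map lift (board m) → NonAttacking Z →
  + length (filter (free? Z) (lastColumn m)) ≡ + m - + below Z
lastColumn-free m Z Z⊆ v = +-difference (begin
  length (filter (free? Z) (lastColumn m)) ℕ.+ below Z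
    ≡⟨ cong₂ ℕ._+_ (length-filter-map (free? Z) (suc m ,_) (range m)) (sym (List.length-map (exitRow m) (filter belowDiagonal? Z))) ⟩
  length (filter (λ j → free? Z (suc m , j)) (range m)) ℕ.+ length V
    ≡⟨ cong (ℕ._+ length V) (length-filter-cong (λ j → free? Z (suc m , j)) (λ j → ¬? (j ∈? V)) (range m) (All.tabulate λ {j} j∈ → mk⇔ (to j) (from j (proj₂ (∈-range⁻ j∈))))) ⟩
  length (filter (λ j → ¬? (j ∈? V)) (range m)) ℕ.+ length V
    ≡⟨ length-filter-∉ (range-unique m) V-unique V⊆range ⟩
  length (range m)
    ≡⟨ List.length-applyUpTo suc m ⟩
  m ∎)
  where
  V = map (exitRow m) (filter belowDiagonal? Z)
  inBoard : All (_∈ map lift (board m)) Z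
  inBoard = All-resp-⊆ Z⊆ (All.tabulate id)
  column≤ : All (λ t → column t ≤ m) Z
  column≤ = All.map (λ t∈ → proj₂ (proj₁ (∈-lift⁻ {m} t∈))) inBoard
  exitRow-injective : ∀ {s t} → column s ≤ m → column t ≤ m → s ≢ t × ¬ Attacks s t → exitRow m s ≢ exitRow m t
  exitRow-injective {s} {t} cs≤ ct≤ (s≢t , ¬attack) eq = ¬attack (s≢t , inj₂ (aligned⁺ s t
    -- With this summand added, the claim is the sum of the two instances of `exitRow-spec`, free of
    -- truncated subtraction.
    (ℕ.+-cancelˡ-≡ (suc m ℕ.+ exitRow m s) _ _ (begin
      suc m ℕ.+ exitRow m s ℕ.+ (column s ℕ.+ row t)      ≡⟨ rearrange₁ (suc m) (exitRow m s) (column s) (row t) ⟩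
      (column s ℕ.+ exitRow m s) ℕ.+ (suc m ℕ.+ row t)    ≡⟨ cong₂ ℕ._+_ (exitRow-spec m s cs≤) (sym (exitRow-spec m t ct≤)) ⟩
      (suc m ℕ.+ row s) ℕ.+ (column t ℕ.+ exitRow m t)    ≡⟨ cong (λ z → suc m ℕ.+ row s ℕ.+ (column t ℕ.+ z)) (sym eq) ⟩
      (suc m ℕ.+ row s) ℕ.+ (column t ℕ.+ exitRow m s)    ≡⟨ rearrange₂ (suc m) (row s) (column t) (exitRow m s) ⟩
      suc m ℕ.+ exitRow m s ℕ.+ (column t ℕ.+ row s)      ∎))))
    where
    rearrange₁ : ∀ M x c r → M ℕ.+ x ℕ.+ (c ℕ.+ r) ≡ c ℕ.+ x ℕ.+ (M ℕ.+ r)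
    rearrange₁ = ℕSolver.solve-∀
    rearrange₂ : ∀ M r c x → M ℕ.+ r ℕ.+ (c ℕ.+ x) ≡ M ℕ.+ x ℕ.+ (c ℕ.+ r)
    rearrange₂ = ℕSolver.solve-∀
  V-unique : Unique V
  V-unique = AllPairs.map⁺ (AllPairs.filter⁺ belowDiagonal?
    (AllPairs-refine exitRow-injective column≤ (AllPairs.zip (AllPairs-resp-⊆ Z⊆ (lift-board-unique m) , v))))
  V⊆range : ∀ {j} → j ∈ V → j ∈ range m
  V⊆range j∈V with t , t∈ , refl ← ∈-map⁻ (exitRow m) j∈V
    with t∈Z , r<c ← ∈-filter⁻ belowDiagonal? {xs = Z} t∈
    with (_ , c≤m) , (1≤r , _) , _ ← ∈-lift⁻ {m} (All.lookup inBoard t∈Z) =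
    ∈-range⁺ (ℕ.≤-trans 1≤r (ℕ.m≤m+n _ _))
      (ℕ.s≤s⁻¹ (subst (exitRow m t <_) (ℕ.m+[n∸m]≡n (ℕ.m≤n⇒m≤1+n c≤m)) (ℕ.+-monoˡ-< (suc m ∸ column t) r<c)))
  to : ∀ j → Free Z (suc m , j) → j ∉ V
  to j free j∈V with t , t∈ , refl ← ∈-map⁻ (exitRow m) j∈V
    with t∈Z , _ ← ∈-filter⁻ belowDiagonal? {xs = Z} t∈ =
    All.lookup free t∈Z
      ( (λ eq → ℕ.<⇒≢ (s≤s (All.lookup column≤ t∈Z)) (sym (cong proj₁ eq)))
      , inj₂ (aligned⁺ (suc m , exitRow m t) t (sym (exitRow-spec m t (All.lookup column≤ t∈Z)))))
  from : ∀ j → j ≤ m → j ∉ V → Free Z (suc m , j)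
  from j j≤m j∉V = All.tabulate ¬attack
    where
    ¬attack : ∀ {t} → t ∈ Z → ¬ Attacks (suc m , j) t
    ¬attack     t∈Z (_ , inj₁ eq) = ℕ.<⇒≢ (s≤s (All.lookup column≤ t∈Z)) (sym eq)
    ¬attack {t} t∈Z (_ , inj₂ eq) = j∉V (subst (_∈ V) exitRow≡j (∈-map⁺ (exitRow m) (∈-filter⁺ belowDiagonal? t∈Z (ℕ.≰⇒> c≰r))))
      where
      aligned : suc m ℕ.+ row t ≡ column t ℕ.+ j
      aligned = aligned⁻ (suc m , j) t eq
      exitRow≡j : exitRow m t ≡ j
      exitRow≡j = ℕ.+-cancelˡ-≡ (column t) _ _ (trans (exitRow-spec m t (All.lookup column≤ t∈Z)) aligned)
      -- As j ≤ m, the square (m + 1, j) is below the main diagonal, and so is every square on its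
      -- diagonal.
      c≰r : ¬ (column t ≤ row t)
      c≰r c≤r = ℕ.<⇒≢ (subst (_< suc m ℕ.+ row t) (ℕ.+-comm j (column t)) (ℕ.+-mono-<-≤ (s≤s j≤m) c≤r)) (sym aligned)

-- The recurrence

-- At the counts of a placement off the diagonal, this is the sum of `G` over the placement and its
-- extensions by one diagonal square.
addDiagonal : ℕ → (ℕ → ℕ → ℤ) → ℕ → ℕ → ℤ
addDiagonal m G k p = G k p + (+ suc m - + k) * G (suc k) p

addColumn : ℕ → (ℕ → ℕ → ℤ) → ℕ → ℕ → ℤ
addColumn m G k p = G k p + (+ m - + p) * G (suc k) (suc p)

Σ⊆-diagonal : ∀ m G Y → Y ⊆ rest m → Σ⊆ (λ X → weight G (X ++ Y)) (diagonal (suc m)) ≡ weight (addDiagonal m G) Y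
Σ⊆-diagonal m G Y Y⊆ = Σ⊆-line-weight G 0 (λ k _ → + suc m - + k) Y (diagonal (suc m))
  (AllPairs.map⁺ (AllPairs.map (λ {i} {j} i≢j → i≢j ∘ cong proj₁ , inj₂ (aligned⁺ (i , i) (j , j) (ℕ.+-comm i j))) (range-unique (suc m))))
  (All.map⁺ (All.tabulate λ {i} _ → cong length (List.filter-reject belowDiagonal? {i , i} {Y} (ℕ.n≮n i))))
  (diagonal-free m Y Y⊆)

Σ⊆-lastColumn : ∀ m G Z → Z ⊆ map lift (board m) → Σ⊆ (λ X → weight G (X ++ Z)) (lastColumn m) ≡ weight (addColumn m G) Z
Σ⊆-lastColumn m G Z Z⊆ = Σ⊆-line-weight G 1 (λ _ p → + m - + p) Z (lastColumn m)
  (AllPairs.map⁺ (AllPairs.map (λ i≢j → i≢j ∘ cong proj₂ , inj₁ refl) (range-unique m)))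
  (All.map⁺ (All.tabulate λ {j} j∈ → cong length (List.filter-accept belowDiagonal? {suc m , j} {Z} (s≤s (proj₂ (∈-range⁻ j∈))))))
  (lastColumn-free m Z Z⊆)

total : ℕ → (ℕ → ℕ → ℤ) → ℤ
total m G = Σ⊆ (weight G) (board m)

-- The operators compose in the order opposite to that in which pieces are placed: the diagonal is
-- filled last, since its free squares depend on the column, and is therefore summed first.
total-suc : ∀ m G → total (suc m) G ≡ total m (addColumn m (addDiagonal m G))
total-suc m G = begin
  Σ⊆ (weight G) (board (suc m))                                                    ≡⟨ Σ⊆-↭ (weight-↭ G) (board-decomposition m) ⟩
  Σ⊆ (weight G) (diagonal (suc m) ++ rest m)                                       ≡⟨ Σ⊆-++ (weight G) (diagonal (suc m)) (rest m) ⟩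
  Σ⊆ (λ Y → Σ⊆ (λ X → weight G (X ++ Y)) (diagonal (suc m))) (rest m)              ≡⟨ Σ⊆-cong (rest m) (Σ⊆-diagonal m G) ⟩
  Σ⊆ (weight G₁) (lastColumn m ++ map lift (board m))                              ≡⟨ Σ⊆-++ (weight G₁) (lastColumn m) (map lift (board m)) ⟩
  Σ⊆ (λ Z → Σ⊆ (λ X → weight G₁ (X ++ Z)) (lastColumn m)) (map lift (board m))     ≡⟨ Σ⊆-cong (map lift (board m)) (Σ⊆-lastColumn m G₁) ⟩
  Σ⊆ (weight G₂) (map lift (board m))                                              ≡⟨ Σ⊆-map (weight G₂) lift (board m) ⟩
  Σ⊆ (weight G₂ ∘ map lift) (board m)                                              ≡⟨ Σ⊆-cong (board m) (λ P _ → weight-lift G₂ P) ⟩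
  Σ⊆ (weight G₂) (board m)                                                         ∎
  where
  G₁ = addDiagonal m G
  G₂ = addColumn m G₁

weight-+ : ∀ G H P → weight (λ k p → G k p + H k p) P ≡ weight G P + weight H P
weight-+ G H P with does (nonAttacking? P)
... | true  = refl
... | false = refl

weight-* : ∀ c G P → weight (λ k p → c * G k p) P ≡ c * weight G P
weight-* c G P with does (nonAttacking? P)
... | true  = refl
... | false = sym (ℤ.*-zeroʳ c)

total-cong : ∀ m {G H} → (∀ k p → G k p ≡ H k p) → total m G ≡ total m H
total-cong m {G} {H} G≗H = Σ⊆-cong (board m) λ P _ → weight-≡ G H P P id id λ _ → G≗H (length P) (below P)

total-+ : ∀ m G H → total m (λ k p → G k p + H k p) ≡ total m G + total m H
total-+ m G H = trans (Σ⊆-cong (board m) λ P _ → weight-+ G H P) (Σ⊆-+ (weight G) (weight H) (board m))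

total-* : ∀ m c G → total m (λ k p → c * G k p) ≡ c * total m G
total-* m c G = trans (Σ⊆-cong (board m) λ P _ → weight-* c G P) (Σ⊆-* c (weight G) (board m))

-- Specialisation to indicators of the two counts

δℤ : ℤ → ℤ → ℤ
δℤ x y = if does (x ℤ.≟ y) then 1ℤ else 0ℤ

δℤ-refl : ∀ x → δℤ x x ≡ 1ℤ
δℤ-refl x = cong (if_then 1ℤ else 0ℤ) (dec-true (x ℤ.≟ x) refl)

δℤ-≢ : ∀ {x y} → x ≢ y → δℤ x y ≡ 0ℤ
δℤ-≢ {x} {y} x≢y = cong (if_then 1ℤ else 0ℤ) (dec-false (x ℤ.≟ y) x≢y)

-- The targets are integers because K - 1, K - 2 and P - 1 may be negative; there the indicator
-- vanishes, as `A-S` does.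
indicator : ℤ → ℤ → ℕ → ℕ → ℤ
indicator K P k p = δℤ (+ k) K * δℤ (+ p) P

A-S≡total : ∀ m K P → + A-S m K P ≡ total m (indicator K P)
A-S≡total m (+ k) (+ p) = trans (length-filter-subsets (placement? k p) (board m)) (Σ⊆-cong (board m) λ X _ → eq X)
  where
  eq : ∀ X → (if does (placement? k p X) then 1ℤ else 0ℤ) ≡ weight (indicator (+ k) (+ p)) X
  eq X = bools (does (length X ℕ.≟ k)) (does (nonAttacking? X)) (does (below X ℕ.≟ p))
    where
    bools : ∀ a b c → (if a ∧ b ∧ c then 1ℤ else 0ℤ) ≡ (if b then (if a then 1ℤ else 0ℤ) * (if c then 1ℤ else 0ℤ) else 0ℤ)
    bools true  true  true  = refl
    bools true  true  false = refl
    bools true  false _     = refl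
    bools false true  true  = refl
    bools false true  false = refl
    bools false false _     = refl
A-S≡total m (+ k) -[1+ p ] = sym (trans (total-cong m λ k′ p′ → ℤ.*-zeroʳ (δℤ (+ k′) (+ k))) (total-* m 0ℤ (λ _ _ → 0ℤ)))
A-S≡total m -[1+ k ] (+ p) = sym (total-* m 0ℤ (λ _ p′ → δℤ (+ p′) (+ p)))
A-S≡total m -[1+ k ] -[1+ p ] = sym (total-* m 0ℤ (λ _ _ → 0ℤ))

-- Replaces a factor depending on the placement by one depending only on the target counts, which
-- can be taken out of the sum.
δℤ-weight : ∀ (f : ℤ → ℤ) x y z → f x * (δℤ x y * z) ≡ f y * (δℤ x y * z)
δℤ-weight f x y z with x ℤ.≟ y
... | yes refl = refl
... | no  x≢y  = trans (ℤ.*-zeroʳ (f x)) (sym (ℤ.*-zeroʳ (f y)))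

δℤ-suc : ∀ k K → δℤ (+ suc k) K ≡ δℤ (+ k) (K - 1ℤ)
δℤ-suc k K with + suc k ℤ.≟ K
... | yes refl = sym (δℤ-refl (+ k))
... | no  ≢K   = sym (δℤ-≢ {+ k} {K - 1ℤ} λ eq → ≢K (trans (cong (_+_ 1ℤ) eq) (lemma K)))
  where
  lemma : ∀ K → 1ℤ + (K - 1ℤ) ≡ K
  lemma = solve-∀

A-S-rec : ∀ m K P →
  + A-S (suc m) K P
    ≡ + A-S m K P
      + (+ suc m - K + 1ℤ) * + A-S m (K - 1ℤ) P
      + (+ suc m - P) * + A-S m (K - 1ℤ) (P - 1ℤ)
      + (+ suc m - P) * (+ suc m - K + 1ℤ) * + A-S m (K - + 2) (P - 1ℤ)
A-S-rec m K P = begin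
  + A-S (suc m) K P                                        ≡⟨ A-S≡total (suc m) K P ⟩
  total (suc m) (indicator K P)                                ≡⟨ total-suc m (indicator K P) ⟩
  total m (addColumn m (addDiagonal m (indicator K P)))        ≡⟨ total-cong m pointwise ⟩
  total m (λ k p → g₁ k p + a * g₂ k p + b * g₃ k p + b * a * g₄ k p)
    ≡⟨ total-+ m (λ k p → g₁ k p + a * g₂ k p + b * g₃ k p) (λ k p → b * a * g₄ k p) ⟩
  total m (λ k p → g₁ k p + a * g₂ k p + b * g₃ k p) + total m (λ k p → b * a * g₄ k p)
    ≡⟨ cong₂ _+_ (total-+ m (λ k p → g₁ k p + a * g₂ k p) (λ k p → b * g₃ k p)) (total-* m (b * a) g₄) ⟩
  total m (λ k p → g₁ k p + a * g₂ k p) + total m (λ k p → b * g₃ k p) + b * a * total m g₄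
    ≡⟨ cong (_+ b * a * total m g₄) (cong₂ _+_ (total-+ m g₁ (λ k p → a * g₂ k p)) (total-* m b g₃)) ⟩
  total m g₁ + total m (λ k p → a * g₂ k p) + b * total m g₃ + b * a * total m g₄
    ≡⟨ cong (λ z → total m g₁ + z + b * total m g₃ + b * a * total m g₄) (total-* m a g₂) ⟩
  total m g₁ + a * total m g₂ + b * total m g₃ + b * a * total m g₄
    ≡⟨ cong₂ _+_ (cong₂ _+_ (cong₂ (λ x y → x + a * y) (A-S≡total m K P) (A-S≡total m (K - 1ℤ) P)) (cong (b *_) (A-S≡total m (K - 1ℤ) (P - 1ℤ)))) (cong (b * a *_) (A-S≡total m (K - + 2) (P - 1ℤ))) ⟨
  _ ∎
  where
  a = + suc m - K + 1ℤ
  b = + suc m - P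
  g₁ g₂ g₃ g₄ : ℕ → ℕ → ℤ
  g₁ = indicator K P
  g₂ = indicator (K - 1ℤ) P
  g₃ = indicator (K - 1ℤ) (P - 1ℤ)
  g₄ = indicator (K - + 2) (P - 1ℤ)
  δ-suc-pred : ∀ k → δℤ (+ suc k) (K - 1ℤ) ≡ δℤ (+ k) (K - + 2)
  δ-suc-pred k = trans (δℤ-suc k (K - 1ℤ)) (cong (δℤ (+ k)) (lemma K))
    where
    lemma : ∀ K → K - 1ℤ - 1ℤ ≡ K - + 2
    lemma = solve-∀
  column-term : ∀ k x → (+ suc m - + k) * (δℤ (+ suc k) K * x) ≡ a * (δℤ (+ k) (K - 1ℤ) * x)
  column-term k x = begin
    (+ suc m - + k) * (δℤ (+ suc k) K * x)             ≡⟨ cong (λ d → (+ suc m - + k) * (d * x)) (δℤ-suc k K) ⟩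
    (+ suc m - + k) * (δℤ (+ k) (K - 1ℤ) * x)          ≡⟨ δℤ-weight (λ z → + suc m - z) (+ k) (K - 1ℤ) x ⟩
    (+ suc m - (K - 1ℤ)) * (δℤ (+ k) (K - 1ℤ) * x)     ≡⟨ cong (_* (δℤ (+ k) (K - 1ℤ) * x)) (lemma (+ suc m) K) ⟩
    a * (δℤ (+ k) (K - 1ℤ) * x)                        ∎
    where
    lemma : ∀ M K → M - (K - 1ℤ) ≡ M - K + 1ℤ
    lemma = solve-∀
  row-term : ∀ p x → (+ m - + p) * (δℤ (+ suc p) P * x) ≡ b * (δℤ (+ p) (P - 1ℤ) * x)
  row-term p x = begin
    (+ m - + p) * (δℤ (+ suc p) P * x)                 ≡⟨ cong (λ d → (+ m - + p) * (d * x)) (δℤ-suc p P) ⟩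
    (+ m - + p) * (δℤ (+ p) (P - 1ℤ) * x)              ≡⟨ δℤ-weight (λ z → + m - z) (+ p) (P - 1ℤ) x ⟩
    (+ m - (P - 1ℤ)) * (δℤ (+ p) (P - 1ℤ) * x)         ≡⟨ cong (_* (δℤ (+ p) (P - 1ℤ) * x)) (lemma (+ m) P) ⟩
    b * (δℤ (+ p) (P - 1ℤ) * x)                        ∎
    where
    lemma : ∀ m P → m - (P - 1ℤ) ≡ 1ℤ + m - P
    lemma = solve-∀
  pointwise : ∀ k p → addColumn m (addDiagonal m (indicator K P)) k p ≡ g₁ k p + a * g₂ k p + b * g₃ k p + b * a * g₄ k p
  pointwise k p = begin
    g₁ k p + (+ suc m - + k) * (δℤ (+ suc k) K * δℤ (+ p) P)
      + (+ m - + p) * (δℤ (+ suc k) K * δℤ (+ suc p) P + (+ suc m - + suc k) * (δℤ (+ suc (suc k)) K * δℤ (+ suc p) P))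
      -- The second use is at `suc k`: the piece in the column already counts when the diagonal is
      -- filled.
      ≡⟨ cong₂ (λ x y → g₁ k p + x + (+ m - + p) * (δℤ (+ suc k) K * δℤ (+ suc p) P + y)) (column-term k (δℤ (+ p) P)) (column-term (suc k) (δℤ (+ suc p) P)) ⟩
    g₁ k p + a * g₂ k p + (+ m - + p) * (δℤ (+ suc k) K * δℤ (+ suc p) P + a * (δℤ (+ suc k) (K - 1ℤ) * δℤ (+ suc p) P))
      ≡⟨ cong (λ z → g₁ k p + a * g₂ k p + (+ m - + p) * z) (factor (δℤ (+ suc k) K) (δℤ (+ suc p) P) a (δℤ (+ suc k) (K - 1ℤ))) ⟩
    g₁ k p + a * g₂ k p + (+ m - + p) * (δℤ (+ suc p) P * (δℤ (+ suc k) K + a * δℤ (+ suc k) (K - 1ℤ)))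
      ≡⟨ cong (λ z → g₁ k p + a * g₂ k p + z) (row-term p (δℤ (+ suc k) K + a * δℤ (+ suc k) (K - 1ℤ))) ⟩
    g₁ k p + a * g₂ k p + b * (δℤ (+ p) (P - 1ℤ) * (δℤ (+ suc k) K + a * δℤ (+ suc k) (K - 1ℤ)))
      ≡⟨ cong₂ (λ x y → g₁ k p + a * g₂ k p + b * (δℤ (+ p) (P - 1ℤ) * (x + a * y))) (δℤ-suc k K) (δ-suc-pred k) ⟩
    g₁ k p + a * g₂ k p + b * (δℤ (+ p) (P - 1ℤ) * (δℤ (+ k) (K - 1ℤ) + a * δℤ (+ k) (K - + 2)))
      ≡⟨ expand (g₁ k p + a * g₂ k p) b (δℤ (+ p) (P - 1ℤ)) (δℤ (+ k) (K - 1ℤ)) a (δℤ (+ k) (K - + 2)) ⟩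
    g₁ k p + a * g₂ k p + b * g₃ k p + b * a * g₄ k p ∎
    where
    factor : ∀ x y a z → x * y + a * (z * y) ≡ y * (x + a * z)
    factor = solve-∀
    expand : ∀ g b y x a z → g + b * (y * (x + a * z)) ≡ g + b * (x * y) + b * a * (z * y)
    expand = solve-∀

-- The closed form

∑< : ℕ → (ℕ → ℤ) → ℤ
∑< N f = foldr _+_ 0ℤ (applyUpTo f N)

∑<-cong : ∀ N {f g} → (∀ j → j < N → f j ≡ g j) → ∑< N f ≡ ∑< N g
∑<-cong zero    f≗g = refl
∑<-cong (suc N) f≗g = cong₂ _+_ (f≗g 0 (s≤s z≤n)) (∑<-cong N λ j j<N → f≗g (suc j) (s≤s j<N))

∑<-zero : ∀ N {f} → (∀ j → j < N → f j ≡ 0ℤ) → ∑< N f ≡ 0ℤ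
∑<-zero zero    f≗0 = refl
∑<-zero (suc N) f≗0 = cong₂ _+_ (f≗0 0 (s≤s z≤n)) (∑<-zero N λ j j<N → f≗0 (suc j) (s≤s j<N))

∑<-snoc : ∀ N f → ∑< (suc N) f ≡ ∑< N f + f N
∑<-snoc zero    f = ℤ.+-comm (f 0) 0ℤ
∑<-snoc (suc N) f = trans (cong (_+_ (f 0)) (∑<-snoc N (f ∘ suc))) (sym (ℤ.+-assoc (f 0) _ _))

∑<-pad : ∀ N {f} → f N ≡ 0ℤ → ∑< N f ≡ ∑< (suc N) f
∑<-pad N {f} fN≡0 = sym (trans (∑<-snoc N f) (trans (cong (_+_ (∑< N f)) fN≡0) (ℤ.+-identityʳ _)))

∑<-+ : ∀ N f g → ∑< N (λ j → f j + g j) ≡ ∑< N f + ∑< N g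
∑<-+ zero    f g = refl
∑<-+ (suc N) f g = trans (cong (_+_ (f 0 + g 0)) (∑<-+ N (f ∘ suc) (g ∘ suc))) (+-interchange (f 0) (g 0) (∑< N (f ∘ suc)) (∑< N (g ∘ suc)))

∑<-* : ∀ N c f → ∑< N (λ j → c * f j) ≡ c * ∑< N f
∑<-* zero    c f = sym (ℤ.*-zeroʳ c)
∑<-* (suc N) c f = trans (cong (_+_ (c * f 0)) (∑<-* N c (f ∘ suc))) (sym (ℤ.*-distribˡ-+ c _ _))

-- Stirling numbers, factorials and binomial coefficients

pos-suc : ∀ n → + suc n ≡ + n + 1ℤ
pos-suc n = trans (ℤ.pos-+ 1 n) (ℤ.+-comm 1ℤ (+ n))

S₂ : ℕ → ℤ → ℤ
S₂ n r = + stirling₂ℤ (+ n) r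

stirling₂-above : ∀ n r → n < r → stirling₂ n r ≡ 0
stirling₂-above zero    (suc r) _         = refl
stirling₂-above (suc n) (suc r) (s≤s n<r)
  rewrite stirling₂-above n (suc r) (ℕ.m≤n⇒m≤1+n n<r) | stirling₂-above n r n<r = trans (ℕ.+-identityʳ _) (ℕ.*-zeroʳ r)

stirling₂-diag : ∀ n → stirling₂ n n ≡ 1
stirling₂-diag zero    = refl
stirling₂-diag (suc n)
  rewrite stirling₂-above n (suc n) ℕ.≤-refl | stirling₂-diag n = cong (ℕ._+ 1) (ℕ.*-zeroʳ n)

S₂-neg : ∀ n r → S₂ n -[1+ r ] ≡ 0ℤ
S₂-neg zero    r = refl
S₂-neg (suc n) r = refl

-- Holds for every integer lower index because both sides vanish at negative ones; the indices m - k
-- + j + 1 of the closed form can be negative.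
S₂-suc : ∀ n r → S₂ (suc n) r ≡ r * S₂ n r + S₂ n (r - 1ℤ)
S₂-suc n       (+ zero)  = sym (S₂-neg n 0)
S₂-suc n       +[1+ r ]  = cong₂ _+_ (ℤ.pos-* (suc r) (stirling₂ n (suc r))) refl
S₂-suc n       -[1+ r ]  = sym (begin
  -[1+ r ] * S₂ n -[1+ r ] + S₂ n (-[1+ r ] - 1ℤ) ≡⟨ cong₂ _+_ (cong (-[1+ r ] *_) (S₂-neg n r)) (S₂-neg n (suc (r ℕ.+ 0))) ⟩
  -[1+ r ] * 0ℤ + 0ℤ                            ≡⟨ cong (_+ 0ℤ) (ℤ.*-zeroʳ -[1+ r ]) ⟩
  0ℤ                                            ∎)

S₂-suc′ : ∀ n r → S₂ (suc n) (r + 1ℤ) ≡ (r + 1ℤ) * S₂ n (r + 1ℤ) + S₂ n r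
S₂-suc′ n r = trans (S₂-suc n (r + 1ℤ)) (cong (λ x → (r + 1ℤ) * S₂ n (r + 1ℤ) + S₂ n x) (lemma r))
  where
  lemma : ∀ r → r + 1ℤ - 1ℤ ≡ r
  lemma = solve-∀

-- rising n j = (n + 1) ⋯ (n + j)
rising : ℤ → ℕ → ℤ
rising n zero    = 1ℤ
rising n (suc j) = rising n j * (n + + suc j)

-- Accounts for the shift of n = m - k by one between the terms of the recurrence.
rising-head : ∀ n j → rising (n - 1ℤ) (suc j) ≡ n * rising n j
rising-head n zero    = lemma n
  where
  lemma : ∀ n → 1ℤ * (n - 1ℤ + 1ℤ) ≡ n * 1ℤ
  lemma = solve-∀
rising-head n (suc j) = begin
  rising (n - 1ℤ) (suc j) * (n - 1ℤ + + suc (suc j)) ≡⟨ cong₂ (λ x y → x * (n - 1ℤ + y)) (rising-head n j) (pos-suc (suc j)) ⟩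
  n * rising n j * (n - 1ℤ + (+ suc j + 1ℤ))         ≡⟨ lemma n (rising n j) (+ suc j) ⟩
  n * (rising n j * (n + + suc j))                   ∎
  where
  lemma : ∀ n r j → n * r * (n - 1ℤ + (j + 1ℤ)) ≡ n * (r * (n + j))
  lemma = solve-∀

rising-head′ : ∀ n j → rising n (suc j) ≡ (n + 1ℤ) * rising (n + 1ℤ) j
rising-head′ n j = trans (cong (λ x → rising x (suc j)) (lemma n)) (rising-head (n + 1ℤ) j)
  where
  lemma : ∀ n → n ≡ n + 1ℤ - 1ℤ
  lemma = solve-∀

rising-vanish : ∀ i j → suc i ≤ j → rising (- + suc i) j ≡ 0ℤ
rising-vanish i (suc j) (s≤s i≤j) with ℕ.m≤n⇒m<n∨m≡n i≤j
... | inj₁ i<j  rewrite rising-vanish i j i<j = refl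
... | inj₂ refl = trans (cong (rising -[1+ i ] i *_) (ℤ.n⊖n≡0 (suc i))) (ℤ.*-zeroʳ (rising -[1+ i ] i))

fallingFactorial-suc : ∀ x j → fallingFactorial (x + 1ℤ) (suc j) ≡ (x + 1ℤ) * fallingFactorial x j
fallingFactorial-suc x zero    = lemma x
  where
  lemma : ∀ x → 1ℤ * (x + 1ℤ - 0ℤ) ≡ (x + 1ℤ) * 1ℤ
  lemma = solve-∀
fallingFactorial-suc x (suc j) = begin
  fallingFactorial (x + 1ℤ) (suc j) * (x + 1ℤ - + suc j) ≡⟨ cong₂ (λ a b → a * (x + 1ℤ - b)) (fallingFactorial-suc x j) (pos-suc j) ⟩
  (x + 1ℤ) * fallingFactorial x j * (x + 1ℤ - (+ j + 1ℤ)) ≡⟨ lemma x (fallingFactorial x j) (+ j) ⟩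
  (x + 1ℤ) * (fallingFactorial x j * (x - + j)) ∎
  where
  lemma : ∀ x f j → (x + 1ℤ) * f * (x + 1ℤ - (j + 1ℤ)) ≡ (x + 1ℤ) * (f * (x - j))
  lemma = solve-∀

fallingFactorial≡rising : ∀ n j → fallingFactorial (n + + j) j ≡ rising n j
fallingFactorial≡rising n zero    = refl
fallingFactorial≡rising n (suc j) = begin
  fallingFactorial (n + + suc j) (suc j)            ≡⟨ cong (λ x → fallingFactorial x (suc j)) (eq n j) ⟩
  fallingFactorial (n + + j + 1ℤ) (suc j)           ≡⟨ fallingFactorial-suc (n + + j) j ⟩
  (n + + j + 1ℤ) * fallingFactorial (n + + j) j     ≡⟨ cong₂ _*_ (sym (eq n j)) (fallingFactorial≡rising n j) ⟩
  (n + + suc j) * rising n j                             ≡⟨ ℤ.*-comm (n + + suc j) (rising n j) ⟩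
  rising n j * (n + + suc j)                             ∎
  where
  eq : ∀ n j → n + + suc j ≡ n + + j + 1ℤ
  eq n j = trans (cong (_+_ n) (pos-suc j)) (sym (ℤ.+-assoc n (+ j) 1ℤ))

-- β q j is the binomial coefficient of q - 1 over j.
β : ℕ → ℕ → ℤ
β zero    zero    = 1ℤ
β zero    (suc j) = - β zero j
β (suc q) zero    = 1ℤ
β (suc q) (suc j) = β q (suc j) + β q j

β-0 : ∀ q → β q 0 ≡ 1ℤ
β-0 zero    = refl
β-0 (suc q) = refl

-- Induction by Pascal's rule, so that no factorial is divided by; at q = 0, where the upper index
-- is -1, it is the alternation of signs.
β-absorb : ∀ q j → + suc j * β q (suc j) ≡ (+ q - + suc j) * β q j
β-absorb zero    j       = lemma (+ suc j) (β 0 j)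
  where
  lemma : ∀ j b → j * - b ≡ (0ℤ - j) * b
  lemma = solve-∀
β-absorb (suc q) zero    = begin
  1ℤ * (β q 1 + β q 0)          ≡⟨ ℤ.*-distribˡ-+ 1ℤ (β q 1) (β q 0) ⟩
  1ℤ * β q 1 + 1ℤ * β q 0       ≡⟨ cong₂ _+_ (β-absorb q 0) refl ⟩
  (+ q - 1ℤ) * β q 0 + 1ℤ * β q 0 ≡⟨ lemma (+ q) (β q 0) ⟩
  (+ q + 1ℤ - 1ℤ) * β q 0     ≡⟨ cong₂ (λ x y → (x - 1ℤ) * y) (sym (pos-suc q)) (β-0 q) ⟩
  (+ suc q - 1ℤ) * 1ℤ     ∎
  where
  lemma : ∀ q b → (q - 1ℤ) * b + 1ℤ * b ≡ (q + 1ℤ - 1ℤ) * b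
  lemma = solve-∀
β-absorb (suc q) (suc j) = begin
  + suc (suc j) * (β q (suc (suc j)) + β q (suc j))               ≡⟨ ℤ.*-distribˡ-+ (+ suc (suc j)) (β q (suc (suc j))) (β q (suc j)) ⟩
  + suc (suc j) * β q (suc (suc j)) + + suc (suc j) * β q (suc j) ≡⟨ cong₂ _+_ (β-absorb q (suc j)) (cong (_* β q (suc j)) (pos-suc (suc j))) ⟩
  (+ q - + suc (suc j)) * β q (suc j) + (+ suc j + 1ℤ) * β q (suc j) ≡⟨ cong (λ x → (+ q - x) * β q (suc j) + (+ suc j + 1ℤ) * β q (suc j)) (pos-suc (suc j)) ⟩
  (+ q - (+ suc j + 1ℤ)) * β q (suc j) + (+ suc j + 1ℤ) * β q (suc j) ≡⟨ lemma₁ (+ q) (+ suc j) (β q (suc j)) ⟩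
  (+ q - + suc j) * β q (suc j) + + suc j * β q (suc j)           ≡⟨ cong (_+_ ((+ q - + suc j) * β q (suc j))) (β-absorb q j) ⟩
  (+ q - + suc j) * β q (suc j) + (+ q - + suc j) * β q j         ≡⟨ lemma₂ (+ q) (+ suc j) (β q (suc j)) (β q j) ⟩
  (+ q + 1ℤ - (+ suc j + 1ℤ)) * (β q (suc j) + β q j)             ≡⟨ cong₂ (λ x y → (x - y) * (β q (suc j) + β q j)) (sym (pos-suc q)) (sym (pos-suc (suc j))) ⟩
  (+ suc q - + suc (suc j)) * (β q (suc j) + β q j)               ∎
  where
  lemma₁ : ∀ q j b → (q - (j + 1ℤ)) * b + (j + 1ℤ) * b ≡ (q - j) * b + j * b
  lemma₁ = solve-∀
  lemma₂ : ∀ q j b c → (q - j) * b + (q - j) * c ≡ (q + 1ℤ - (j + 1ℤ)) * (b + c)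
  lemma₂ = solve-∀

-- Absorption trades the new factor q - 1 - j of the falling factorial for the new factor j + 1 of
-- the factorial. This makes the division in `binomial⁺` exact.
fallingFactorial≡β*! : ∀ q j → fallingFactorial (+ q - 1ℤ) j ≡ β q j * + (j !)
fallingFactorial≡β*! q zero    = sym (cong (_* 1ℤ) (β-0 q))
fallingFactorial≡β*! q (suc j) = begin
  fallingFactorial (+ q - 1ℤ) j * (+ q - 1ℤ - + j) ≡⟨ cong (_* (+ q - 1ℤ - + j)) (fallingFactorial≡β*! q j) ⟩
  β q j * + (j !) * (+ q - 1ℤ - + j)               ≡⟨ lemma₁ (β q j) (+ (j !)) (+ q) (+ j) ⟩
  (+ q - (+ j + 1ℤ)) * β q j * + (j !)             ≡⟨ cong (λ x → (+ q - x) * β q j * + (j !)) (sym (pos-suc j)) ⟩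
  (+ q - + suc j) * β q j * + (j !)                ≡⟨ cong (_* + (j !)) (sym (β-absorb q j)) ⟩
  + suc j * β q (suc j) * + (j !)                  ≡⟨ lemma₂ (+ suc j) (β q (suc j)) (+ (j !)) ⟩
  β q (suc j) * (+ suc j * + (j !))                ≡⟨ cong (β q (suc j) *_) (sym (ℤ.pos-* (suc j) (j !))) ⟩
  β q (suc j) * + (suc j !)                        ∎
  where
  lemma₁ : ∀ b f q j → b * f * (q - 1ℤ - j) ≡ (q - (j + 1ℤ)) * b * f
  lemma₁ = solve-∀
  lemma₂ : ∀ j b f → j * b * f ≡ b * (j * f)
  lemma₂ = solve-∀

-- The floor quotient x is pinned by x d ≤ i d < (x + 1) d.
i*d/ℕd≡i : ∀ i d .{{_ : ℕ.NonZero d}} → (i * + d) /ℕ d ≡ i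
i*d/ℕd≡i i d@(suc _) = ℤ.≤-antisym
  (ℤ.*-cancelʳ-≤-pos x i (+ d) (ℤ.[n/ℕd]*d≤n (i * + d) d))
  (subst (i ℤ.≤_) (ℤ.pred-suc x) (ℤ.i<j⇒i≤pred[j] (ℤ.*-cancelʳ-<-nonNeg {i} {ℤ.suc x} (+ d) (ℤ.n<s[n/ℕd]*d (i * + d) d))))
  where
  x = (i * + d) /ℕ d

binomial⁺≡β : ∀ q j → binomial⁺ (+ q - 1ℤ) j ≡ β q j
binomial⁺≡β q j = trans
  (cong (λ x → (x /ℕ (j !)) {{j ℕ.!≢0}}) (fallingFactorial≡β*! q j))
  (i*d/ℕd≡i (β q j) (j !) {{j ℕ.!≢0}})

-- e q i is the binomial coefficient of q + i over q, and E q p j is e q (p - j), which is 0 for j > p.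
e : ℕ → ℕ → ℤ
e q       zero    = 1ℤ
e zero    (suc i) = 1ℤ
e (suc q) (suc i) = e q (suc i) + e (suc q) i

E : ℕ → ℕ → ℕ → ℤ
E q p       zero    = e q p
E q zero    (suc j) = 0ℤ
E q (suc p) (suc j) = E q p j

E-vanish : ∀ q p → E q p (suc p) ≡ 0ℤ
E-vanish q zero    = refl
E-vanish q (suc p) = E-vanish q p

-- The value 0 beyond `p` is what makes Pascal's rule hold at j = p as well; with truncated
-- subtraction in place of `E` it would read 1 = 1 + 1 there.
E-pascal : ∀ q p j → E (suc q) p j ≡ E (suc q) p (suc j) + E q p j
E-pascal q zero    zero    = refl
E-pascal q (suc p) zero    = ℤ.+-comm (e q (suc p)) (e (suc q) p)
E-pascal q zero    (suc j) = refl
E-pascal q (suc p) (suc j) = E-pascal q p j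

E≡e : ∀ q p j → j ≤ p → E q p j ≡ e q (p ∸ j)
E≡e q p       zero    _         = refl
E≡e q (suc p) (suc j) (s≤s j≤p) = E≡e q p j j≤p

β-above : ∀ q j → q < j → β (suc q) j ≡ 0ℤ
β-above zero    (suc j) (s≤s _)   = ℤ.+-inverseˡ (β 0 j)
β-above (suc q) (suc j) (s≤s q<j) = cong₂ _+_ (β-above q (suc j) (ℕ.m≤n⇒m≤1+n q<j)) (β-above q j q<j)

β-diag : ∀ q → β (suc q) q ≡ 1ℤ
β-diag zero    = refl
β-diag (suc q) = cong₂ _+_ (β-above q (suc q) ℕ.≤-refl) (β-diag q)

e≡β : ∀ q i → e q i ≡ β (suc (q ℕ.+ i)) q
e≡β q       zero    rewrite ℕ.+-identityʳ q = sym (β-diag q)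
e≡β zero    (suc i) = refl
e≡β (suc q) (suc i) = begin
  e q (suc i) + e (suc q) i                                     ≡⟨ cong₂ _+_ (e≡β q (suc i)) (e≡β (suc q) i) ⟩
  β (suc (q ℕ.+ suc i)) q + β (suc (suc (q ℕ.+ i))) (suc q)     ≡⟨ cong (λ x → β (suc (q ℕ.+ suc i)) q + β (suc x) (suc q)) (sym (ℕ.+-suc q i)) ⟩
  β (suc (q ℕ.+ suc i)) q + β (suc (q ℕ.+ suc i)) (suc q)       ≡⟨ ℤ.+-comm (β (suc (q ℕ.+ suc i)) q) _ ⟩
  β (suc (suc q ℕ.+ suc i)) (suc q)                             ∎

-- The binomial coefficient of q - 1 over j - 1.
β⁻ : ℕ → ℕ → ℤ
β⁻ q zero    = 0ℤ
β⁻ q (suc j) = β q j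

β-pascal : ∀ q j → β (suc q) j ≡ β q j + β⁻ q j
β-pascal q zero    = sym (trans (ℤ.+-identityʳ (β q 0)) (β-0 q))
β-pascal q (suc j) = refl

β⁻-absorb : ∀ q j → + j * β q j ≡ (+ q - + j) * β⁻ q j
β⁻-absorb q zero    = sym (ℤ.*-zeroʳ (+ q - 0ℤ))
β⁻-absorb q (suc j) = β-absorb q j

-- The recurrence for the closed form

coeff : ℤ → ℕ → ℕ → ℕ → ℤ
coeff n q p j = rising n j * β q j * E q p j

coeff-vanish : ∀ n q p → coeff n q p (suc p) ≡ 0ℤ
coeff-vanish n q p = trans (cong (rising n (suc p) * β q (suc p) *_) (E-vanish q p)) (ℤ.*-zeroʳ (rising n (suc p) * β q (suc p)))

-- `M` is the side of the board and `n` stands for M - q - p. It is an independent integer here, as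
-- the recurrence holds for each `n` and shifts it in both directions.
closedSum : ℤ → ℕ → ℕ → ℕ → ℤ
closedSum n M q p = ∑< (suc p) (λ j → coeff n q p j * S₂ (suc M) (n + + suc j))

-- After Pascal's rule the two sides differ by multiples of two absorption identities.
coeff-rec : ∀ n q p j →
  coeff n (suc q) p j * (n + + suc j) + coeff n (suc q) p (suc j)
    ≡ coeff (n - 1ℤ) (suc q) p (suc j) + (n + 1ℤ) * coeff n q p j
      + (n + + suc q) * (rising n j * β (suc q) j * E (suc q) p (suc j))
      + (n + + suc q) * (rising n j * β⁻ q j * E q p j)
coeff-rec n q p j = begin
  rising n j * β (suc q) j * E (suc q) p j * (n + + suc j) + rising n j * (n + + suc j) * B₁ * X
    ≡⟨ cong₂ (λ x y → rising n j * x * y * (n + + suc j) + rising n j * (n + + suc j) * B₁ * X) (β-pascal q j) (E-pascal q p j) ⟩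
  rising n j * (b + b⁻) * (X + Y) * (n + + suc j) + rising n j * (n + + suc j) * B₁ * X
    ≡⟨ cong (λ x → rising n j * (b + b⁻) * (X + Y) * (n + x) + rising n j * (n + x) * B₁ * X) (pos-suc j) ⟩
  rising n j * (b + b⁻) * (X + Y) * (n + (+ j + 1ℤ)) + rising n j * (n + (+ j + 1ℤ)) * B₁ * X
    ≡⟨ ring n (rising n j) (+ q) (+ j) b b⁻ B₁ X Y ⟩
  n * rising n j * B₁ * X + (n + 1ℤ) * (rising n j * b * Y) + (n + (+ q + 1ℤ)) * (rising n j * (b + b⁻) * X) + (n + (+ q + 1ℤ)) * (rising n j * b⁻ * Y)
    + (rising n j * X * ((+ j + 1ℤ) * B₁ - (+ q + 1ℤ - (+ j + 1ℤ)) * (b + b⁻)) + rising n j * Y * (+ j * b - (+ q - + j) * b⁻))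
    ≡⟨ cong₂ (λ x y → n * rising n j * B₁ * X + (n + 1ℤ) * (rising n j * b * Y) + (n + (+ q + 1ℤ)) * (rising n j * (b + b⁻) * X) + (n + (+ q + 1ℤ)) * (rising n j * b⁻ * Y) + (rising n j * X * x + rising n j * Y * y)) zero₁ (ℤ.i≡j⇒i-j≡0 {+ j * b} {(+ q - + j) * b⁻} (β⁻-absorb q j)) ⟩
  n * rising n j * B₁ * X + (n + 1ℤ) * (rising n j * b * Y) + (n + (+ q + 1ℤ)) * (rising n j * (b + b⁻) * X) + (n + (+ q + 1ℤ)) * (rising n j * b⁻ * Y)
    + (rising n j * X * 0ℤ + rising n j * Y * 0ℤ)
    ≡⟨ drop (rising n j * X) (rising n j * Y) _ ⟩
  n * rising n j * B₁ * X + (n + 1ℤ) * (rising n j * b * Y) + (n + (+ q + 1ℤ)) * (rising n j * (b + b⁻) * X) + (n + (+ q + 1ℤ)) * (rising n j * b⁻ * Y)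
    ≡⟨ cong₂ (λ x y → n * rising n j * B₁ * X + (n + 1ℤ) * (rising n j * b * Y) + (n + x) * (rising n j * y * X) + (n + x) * (rising n j * b⁻ * Y)) (sym (pos-suc q)) (sym (β-pascal q j)) ⟩
  n * rising n j * B₁ * X + (n + 1ℤ) * (rising n j * b * Y) + (n + + suc q) * (rising n j * β (suc q) j * X) + (n + + suc q) * (rising n j * b⁻ * Y)
    ≡⟨ cong (λ x → x * B₁ * X + (n + 1ℤ) * (rising n j * b * Y) + (n + + suc q) * (rising n j * β (suc q) j * X) + (n + + suc q) * (rising n j * b⁻ * Y)) (sym (rising-head n j)) ⟩
  rising (n - 1ℤ) (suc j) * B₁ * X + (n + 1ℤ) * (rising n j * b * Y) + (n + + suc q) * (rising n j * β (suc q) j * X) + (n + + suc q) * (rising n j * b⁻ * Y)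
    ∎
  where
  b  = β q j
  b⁻ = β⁻ q j
  B₁ = β (suc q) (suc j)
  X  = E (suc q) p (suc j)
  Y  = E q p j
  zero₁ : (+ j + 1ℤ) * B₁ - (+ q + 1ℤ - (+ j + 1ℤ)) * (b + b⁻) ≡ 0ℤ
  zero₁ = ℤ.i≡j⇒i-j≡0 {(+ j + 1ℤ) * B₁} {(+ q + 1ℤ - (+ j + 1ℤ)) * (b + b⁻)} (begin
    (+ j + 1ℤ) * B₁                                   ≡⟨ cong (_* B₁) (sym (pos-suc j)) ⟩
    + suc j * B₁                                      ≡⟨ β-absorb (suc q) j ⟩
    (+ suc q - + suc j) * β (suc q) j                 ≡⟨ cong₂ (λ x y → (x - y) * β (suc q) j) (pos-suc q) (pos-suc j) ⟩
    (+ q + 1ℤ - (+ j + 1ℤ)) * β (suc q) j             ≡⟨ cong ((+ q + 1ℤ - (+ j + 1ℤ)) *_) (β-pascal q j) ⟩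
    (+ q + 1ℤ - (+ j + 1ℤ)) * (b + b⁻)                ∎)
  ring : ∀ n r q j b c B X Y →
    r * (b + c) * (X + Y) * (n + (j + 1ℤ)) + r * (n + (j + 1ℤ)) * B * X
      ≡ n * r * B * X + (n + 1ℤ) * (r * b * Y) + (n + (q + 1ℤ)) * (r * (b + c) * X) + (n + (q + 1ℤ)) * (r * c * Y)
        + (r * X * ((j + 1ℤ) * B - (q + 1ℤ - (j + 1ℤ)) * (b + c)) + r * Y * (j * b - (q - j) * c))
  ring = solve-∀
  drop : ∀ x y z → z + (x * 0ℤ + y * 0ℤ) ≡ z
  drop = solve-∀

-- The Stirling recurrence spreads each term over two neighbouring values of `σ`. After a shift of
-- the second sum the coefficient of `σ (suc j)` is the left side of `coeff-rec`, and a single term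
-- at `σ 0` is left over.
closedSum-rec : ∀ n M q p →
  closedSum n (suc M) (suc q) (suc p)
    ≡ closedSum (n - 1ℤ) M (suc q) (suc p) + (n + 1ℤ) * closedSum n M q (suc p)
      + (n + + suc q) * closedSum n M (suc q) p + (n + + suc q) * (n + 1ℤ) * closedSum (n + 1ℤ) M q p
closedSum-rec n M q p = begin
  closedSum n (suc M) Q P
    ≡⟨ ∑<-cong N (λ j _ → expand j) ⟩
  ∑< N (λ j → α j * (n + + suc j) * σ (suc j) + α j * σ j)
    ≡⟨ ∑<-+ N (λ j → α j * (n + + suc j) * σ (suc j)) (λ j → α j * σ j) ⟩
  ∑< N (λ j → α j * (n + + suc j) * σ (suc j)) + ∑< N (λ j → α j * σ j)
    ≡⟨ cong (λ x → ∑< N (λ j → α j * (n + + suc j) * σ (suc j)) + x) (∑<-pad N {λ j → α j * σ j} (cong (_* σ N) (coeff-vanish n Q P))) ⟩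
  ∑< N (λ j → α j * (n + + suc j) * σ (suc j)) + (α 0 * σ 0 + ∑< N (λ j → α (suc j) * σ (suc j)))
    ≡⟨ rotate (∑< N (λ j → α j * (n + + suc j) * σ (suc j))) (α 0 * σ 0) (∑< N (λ j → α (suc j) * σ (suc j))) ⟩
  α 0 * σ 0 + (∑< N (λ j → α j * (n + + suc j) * σ (suc j)) + ∑< N (λ j → α (suc j) * σ (suc j)))
    ≡⟨ cong (λ x → α 0 * σ 0 + x) (sym (∑<-+ N (λ j → α j * (n + + suc j) * σ (suc j)) (λ j → α (suc j) * σ (suc j)))) ⟩
  α 0 * σ 0 + ∑< N (λ j → α j * (n + + suc j) * σ (suc j) + α (suc j) * σ (suc j))
    ≡⟨ cong (λ x → α 0 * σ 0 + x) (∑<-cong N (λ j _ → split j)) ⟩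
  α 0 * σ 0 + ∑< N (λ j → f₁ j + (n + 1ℤ) * f₂ j + c * f₃ j + c * f₄ j)
    ≡⟨ cong (λ x → α 0 * σ 0 + x) distribute ⟩
  α 0 * σ 0 + (∑< N f₁ + (n + 1ℤ) * ∑< N f₂ + c * ∑< N f₃ + c * ∑< N f₄)
    ≡⟨ regroup (α 0 * σ 0) (∑< N f₁) ((n + 1ℤ) * ∑< N f₂) (c * ∑< N f₃) (c * ∑< N f₄) ⟩
  α 0 * σ 0 + ∑< N f₁ + (n + 1ℤ) * ∑< N f₂ + c * ∑< N f₃ + c * ∑< N f₄
    ≡⟨ cong₂ _+_ (cong₂ _+_ (cong (_+ (n + 1ℤ) * ∑< N f₂) eq₁) (cong (c *_) eq₃)) (trans (cong (c *_) eq₄) (sym (ℤ.*-assoc c (n + 1ℤ) _))) ⟩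
  closedSum (n - 1ℤ) M Q P + (n + 1ℤ) * closedSum n M q P + c * closedSum n M Q p + c * (n + 1ℤ) * closedSum (n + 1ℤ) M q p ∎
  where
  Q = suc q
  P = suc p
  N = suc P
  c = n + + suc q
  α : ℕ → ℤ
  α = coeff n Q P
  σ : ℕ → ℤ
  σ j = S₂ (suc M) (n + + j)
  f₁ f₂ f₃ f₄ : ℕ → ℤ
  f₁ j = coeff (n - 1ℤ) Q P (suc j) * σ (suc j)
  f₂ j = coeff n q P j * σ (suc j)
  -- This matches the third term of `coeff-rec` because `E Q P (suc j)` reduces to `E Q p j`.
  f₃ j = coeff n Q p j * σ (suc j)
  f₄ j = rising n j * β⁻ q j * E q P j * σ (suc j)
  n+suc : ∀ j → n + + suc j ≡ n + + j + 1ℤ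
  n+suc j = trans (cong (λ x → n + x) (pos-suc j)) (sym (ℤ.+-assoc n (+ j) 1ℤ))
  rotate : ∀ x y z → x + (y + z) ≡ y + (x + z)
  rotate = solve-∀
  regroup : ∀ x y z u v → x + (y + z + u + v) ≡ x + y + z + u + v
  regroup = solve-∀
  expand : ∀ j → α j * S₂ (suc (suc M)) (n + + suc j) ≡ α j * (n + + suc j) * σ (suc j) + α j * σ j
  expand j = begin
    α j * S₂ (suc (suc M)) (n + + suc j)                ≡⟨ cong (λ x → α j * S₂ (suc (suc M)) x) (n+suc j) ⟩
    α j * S₂ (suc (suc M)) (n + + j + 1ℤ)               ≡⟨ cong (α j *_) (S₂-suc′ (suc M) (n + + j)) ⟩
    α j * ((n + + j + 1ℤ) * S₂ (suc M) (n + + j + 1ℤ) + σ j) ≡⟨ cong (λ x → α j * (x * S₂ (suc M) x + σ j)) (sym (n+suc j)) ⟩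
    α j * ((n + + suc j) * σ (suc j) + σ j)            ≡⟨ lemma (α j) (n + + suc j) (σ (suc j)) (σ j) ⟩
    α j * (n + + suc j) * σ (suc j) + α j * σ j        ∎
    where
    lemma : ∀ a x y z → a * (x * y + z) ≡ a * x * y + a * z
    lemma = solve-∀
  split : ∀ j → α j * (n + + suc j) * σ (suc j) + α (suc j) * σ (suc j) ≡ f₁ j + (n + 1ℤ) * f₂ j + c * f₃ j + c * f₄ j
  split j = begin
    α j * (n + + suc j) * σ (suc j) + α (suc j) * σ (suc j) ≡⟨ sym (ℤ.*-distribʳ-+ (σ (suc j)) (α j * (n + + suc j)) (α (suc j))) ⟩
    (α j * (n + + suc j) + α (suc j)) * σ (suc j)           ≡⟨ cong (_* σ (suc j)) (coeff-rec n q P j) ⟩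
    _                                                       ≡⟨ lemma (σ (suc j)) (coeff (n - 1ℤ) Q P (suc j)) (n + 1ℤ) (coeff n q P j) c (coeff n Q p j) (rising n j * β⁻ q j * E q P j) ⟩
    f₁ j + (n + 1ℤ) * f₂ j + c * f₃ j + c * f₄ j            ∎
    where
    lemma : ∀ z a b x c y w → (a + b * x + c * y + c * w) * z ≡ a * z + b * (x * z) + c * (y * z) + c * (w * z)
    lemma = solve-∀
  distribute : ∑< N (λ j → f₁ j + (n + 1ℤ) * f₂ j + c * f₃ j + c * f₄ j) ≡ ∑< N f₁ + (n + 1ℤ) * ∑< N f₂ + c * ∑< N f₃ + c * ∑< N f₄
  distribute = trans (∑<-+ N (λ j → f₁ j + (n + 1ℤ) * f₂ j + c * f₃ j) (λ j → c * f₄ j)) (cong₂ _+_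
    (trans (∑<-+ N (λ j → f₁ j + (n + 1ℤ) * f₂ j) (λ j → c * f₃ j)) (cong₂ _+_
      (trans (∑<-+ N f₁ (λ j → (n + 1ℤ) * f₂ j)) (cong (λ x → ∑< N f₁ + x) (∑<-* N (n + 1ℤ) f₂)))
      (∑<-* N c f₃)))
    (∑<-* N c f₄))
  -- The coefficient at j = 0 does not involve `n`, so the term left over at `σ 0` is the initial
  -- term of the sum for n - 1.
  eq₁ : α 0 * σ 0 + ∑< N f₁ ≡ closedSum (n - 1ℤ) M Q P
  eq₁ = begin
    ∑< (suc N) (λ j → coeff (n - 1ℤ) Q P j * σ j)
      ≡⟨ ∑<-pad N {λ j → coeff (n - 1ℤ) Q P j * σ j} (cong (_* σ N) (coeff-vanish (n - 1ℤ) Q P)) ⟨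
    ∑< N (λ j → coeff (n - 1ℤ) Q P j * σ j)
      ≡⟨ ∑<-cong N (λ j _ → cong (λ x → coeff (n - 1ℤ) Q P j * S₂ (suc M) x) (trans (lemma n (+ j)) (cong (λ x → n - 1ℤ + x) (sym (pos-suc j))))) ⟩
    closedSum (n - 1ℤ) M Q P ∎
    where
    lemma : ∀ n j → n + j ≡ n - 1ℤ + (j + 1ℤ)
    lemma = solve-∀
  eq₃ : ∑< N f₃ ≡ closedSum n M Q p
  eq₃ = sym (∑<-pad P {f₃} (cong (_* σ (suc P)) (coeff-vanish n Q p)))
  -- The first term contains `β⁻ q 0`, which is 0; in the others, reindexed, splitting off the first
  -- factor of the rising factorial gives n + 1.
  eq₄ : ∑< N f₄ ≡ (n + 1ℤ) * closedSum (n + 1ℤ) M q p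
  eq₄ = begin
    f₄ 0 + ∑< P (f₄ ∘ suc)    ≡⟨⟩
    0ℤ * E q P 0 * σ 1 + ∑< P (f₄ ∘ suc) ≡⟨ drop (E q P 0) (σ 1) (∑< P (f₄ ∘ suc)) ⟩
    ∑< P (f₄ ∘ suc)           ≡⟨ ∑<-cong P (λ j _ → step j) ⟩
    ∑< P (λ j → (n + 1ℤ) * (coeff (n + 1ℤ) q p j * S₂ (suc M) (n + 1ℤ + + suc j))) ≡⟨ ∑<-* P (n + 1ℤ) (λ j → coeff (n + 1ℤ) q p j * S₂ (suc M) (n + 1ℤ + + suc j)) ⟩
    (n + 1ℤ) * closedSum (n + 1ℤ) M q p ∎
    where
    drop : ∀ x y z → 0ℤ * x * y + z ≡ z
    drop = solve-∀
    step : ∀ j → f₄ (suc j) ≡ (n + 1ℤ) * (coeff (n + 1ℤ) q p j * S₂ (suc M) (n + 1ℤ + + suc j))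
    step j = begin
      rising n (suc j) * β q j * E q p j * S₂ (suc M) (n + + suc (suc j))
        ≡⟨ cong₂ (λ x y → x * β q j * E q p j * S₂ (suc M) y) (rising-head′ n j) (trans (cong (λ x → n + x) (ℤ.pos-+ 1 (suc j))) (sym (ℤ.+-assoc n 1ℤ (+ suc j)))) ⟩
      (n + 1ℤ) * rising (n + 1ℤ) j * β q j * E q p j * S₂ (suc M) (n + 1ℤ + + suc j)
        ≡⟨ lemma (n + 1ℤ) (rising (n + 1ℤ) j) (β q j) (E q p j) (S₂ (suc M) (n + 1ℤ + + suc j)) ⟩
      (n + 1ℤ) * (coeff (n + 1ℤ) q p j * S₂ (suc M) (n + 1ℤ + + suc j)) ∎
      where
      lemma : ∀ a r b e z → a * r * b * e * z ≡ a * (r * b * e * z)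
      lemma = solve-∀

-- Boundary cases of the closed form

-- As `β 0` alternates in sign, the Stirling recurrence writes the j-th term as t j - t (j + 1) with
-- t j = `rising n j * β 0 j * S₂ M (n + + j)`.
∑<-telescope : ∀ n M P →
  ∑< P (λ j → rising n j * β 0 j * S₂ (suc M) (n + + suc j)) ≡ S₂ M n - rising n P * β 0 P * S₂ M (n + + P)
∑<-telescope n M zero    = trans (lemma (S₂ M n)) (cong (λ x → S₂ M n - 1ℤ * 1ℤ * S₂ M x) (sym (ℤ.+-identityʳ n)))
  where
  lemma : ∀ x → 0ℤ ≡ x - 1ℤ * 1ℤ * x
  lemma = solve-∀
∑<-telescope n M (suc P) = begin
  ∑< (suc P) f                      ≡⟨ ∑<-snoc P f ⟩
  ∑< P f + f P                      ≡⟨ cong₂ _+_ (∑<-telescope n M P) (cong (rising n P * β 0 P *_) expand) ⟩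
  S₂ M n - rising n P * β 0 P * S₂ M (n + + P) + rising n P * β 0 P * ((n + + suc P) * S₂ M (n + + suc P) + S₂ M (n + + P))
    ≡⟨ lemma (S₂ M n) (rising n P) (β 0 P) (S₂ M (n + + P)) (n + + suc P) (S₂ M (n + + suc P)) ⟩
  S₂ M n - rising n P * (n + + suc P) * - β 0 P * S₂ M (n + + suc P) ∎
  where
  f : ℕ → ℤ
  f j = rising n j * β 0 j * S₂ (suc M) (n + + suc j)
  n+suc : n + + suc P ≡ n + + P + 1ℤ
  n+suc = trans (cong (λ x → n + x) (pos-suc P)) (sym (ℤ.+-assoc n (+ P) 1ℤ))
  expand : S₂ (suc M) (n + + suc P) ≡ (n + + suc P) * S₂ M (n + + suc P) + S₂ M (n + + P)
  expand = trans (cong (S₂ (suc M)) n+suc) (trans (S₂-suc′ M (n + + P)) (cong (λ x → x * S₂ M x + S₂ M (n + + P)) (sym n+suc)))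
  lemma : ∀ x r b y z w → x - r * b * y + r * b * (z * w + y) ≡ x - r * z * - b * w
  lemma = solve-∀

e-0 : ∀ p → e 0 p ≡ 1ℤ
e-0 zero    = refl
e-0 (suc p) = refl

-- For q = 0 all factors `E` are 1. Since n = M - p, the last term of the telescoping sum contains
-- the Stirling number {M, M + 1} = 0.
closedSum-q0 : ∀ M p → closedSum (+ M - + p) M 0 p ≡ S₂ M (+ M - + p)
closedSum-q0 M p = begin
  closedSum n M 0 p                                             ≡⟨ ∑<-cong (suc p) (λ j j<sp → cong (_* S₂ (suc M) (n + + suc j)) (trans (cong (rising n j * β 0 j *_) (trans (E≡e 0 p j (ℕ.s≤s⁻¹ j<sp)) (e-0 (p ∸ j)))) (ℤ.*-identityʳ (rising n j * β 0 j)))) ⟩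
  ∑< (suc p) (λ j → rising n j * β 0 j * S₂ (suc M) (n + + suc j)) ≡⟨ ∑<-telescope n M (suc p) ⟩
  S₂ M n - rising n (suc p) * β 0 (suc p) * S₂ M (n + + suc p)      ≡⟨ cong (λ x → S₂ M n - rising n (suc p) * β 0 (suc p) * S₂ M x) top ⟩
  S₂ M n - rising n (suc p) * β 0 (suc p) * + stirling₂ M (suc M)  ≡⟨ cong (λ x → S₂ M n - rising n (suc p) * β 0 (suc p) * + x) (stirling₂-above M (suc M) ℕ.≤-refl) ⟩
  S₂ M n - rising n (suc p) * β 0 (suc p) * 0ℤ                     ≡⟨ lemma (S₂ M n) (rising n (suc p) * β 0 (suc p)) ⟩
  S₂ M n ∎
  where
  n = + M - + p
  lemma : ∀ x y → x - y * 0ℤ ≡ x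
  lemma = solve-∀
  top : + M - + p + + suc p ≡ + suc M
  top = trans (cong (λ x → + M - + p + x) (pos-suc p)) (trans (lemma′ (+ M) (+ p)) (sym (pos-suc M)))
    where
    lemma′ : ∀ M p → M - p + (p + 1ℤ) ≡ M + 1ℤ
    lemma′ = solve-∀

-- With n = -k for the number k of pieces, every term has a zero factor: the rising factorial
-- contains n + k if j ≥ k, and the Stirling number is {1, r} with r ≤ 0 if j < k.
closedSum-m0 : ∀ q p → closedSum (0ℤ - + (suc q ℕ.+ p)) 0 (suc q) p ≡ 0ℤ
closedSum-m0 q p = ∑<-zero (suc p) λ j _ → term j
  where
  k = q ℕ.+ p
  n = 0ℤ - + suc k
  lemma : ∀ x y z → 0ℤ * x * y * z ≡ 0ℤ
  lemma = solve-∀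
  s₁-vanish : ∀ j → j < suc k → S₂ 1 (n + + suc j) ≡ 0ℤ
  s₁-vanish j (s≤s j≤k) = trans (cong (S₂ 1) (trans (ℤ.[1+m]⊖[1+n]≡m⊖n j k) (ℤ.⊖-≤ j≤k))) (s₁-neg (k ∸ j))
    where
    s₁-neg : ∀ d → S₂ 1 (- + d) ≡ 0ℤ
    s₁-neg zero    = refl
    s₁-neg (suc d) = refl
  term : ∀ j → coeff n (suc q) p j * S₂ 1 (n + + suc j) ≡ 0ℤ
  term j with suc k ℕ.≤? j
  ... | yes k<j = trans (cong (λ x → x * β (suc q) j * E (suc q) p j * S₂ 1 (n + + suc j)) (rising-vanish k j k<j)) (lemma (β (suc q) j) (E (suc q) p j) (S₂ 1 (n + + suc j)))
  ... | no  k≮j = trans (cong (coeff n (suc q) p j *_) (s₁-vanish j (ℕ.≰⇒> k≮j))) (ℤ.*-zeroʳ (coeff n (suc q) p j))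

closedSum-p0 : ∀ n M q → closedSum n M q 0 ≡ S₂ (suc M) (n + 1ℤ)
closedSum-p0 n M q = trans (cong (λ x → 1ℤ * x * 1ℤ * S₂ (suc M) (n + 1ℤ) + 0ℤ) (β-0 q)) (lemma (S₂ (suc M) (n + 1ℤ)))
  where
  lemma : ∀ x → 1ℤ * 1ℤ * 1ℤ * x + 0ℤ ≡ x
  lemma = solve-∀

-- The closed form in terms of extended binomial coefficients

closedTerm : ℕ → ℕ → ℕ → ℕ → ℤ
closedTerm m k p j =
  fallingFactorial (+ m - + k + + j) j
    * binomial (+ k - + p - 1ℤ) (+ j)
    * binomial (+ k - + j) (+ k - + p)
    * + stirling₂ℤ (+ m + 1ℤ) (+ m - + k + + j + 1ℤ)

closedForm≡closedSum : ∀ m q p → ∑₀ p (closedTerm m (q ℕ.+ p) p) ≡ closedSum (+ m - + (q ℕ.+ p)) m q p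
closedForm≡closedSum m q p = ∑<-cong (suc p) λ j j<sp → term j (ℕ.s≤s⁻¹ j<sp)
  where
  k = q ℕ.+ p
  n = + m - + k
  k-p : + k - + p ≡ + q
  k-p = trans (cong (_- + p) (ℤ.pos-+ q p)) (lemma (+ q) (+ p))
    where
    lemma : ∀ q p → q + p - p ≡ q
    lemma = solve-∀
  -- The upper index is put into the form N - 1 to which `binomial⁺≡β` applies.
  k-j : ∀ j → j ≤ p → + k - + j ≡ + suc (q ℕ.+ (p ∸ j)) - 1ℤ
  k-j j j≤p = begin
    + k - + j                      ≡⟨ ℤ.m-n≡m⊖n k j ⟩
    k ⊖ j                          ≡⟨ ℤ.⊖-≥ (ℕ.≤-trans j≤p (ℕ.m≤n+m p q)) ⟩
    + (k ∸ j)                      ≡⟨ cong +_ (ℕ.+-∸-assoc q j≤p) ⟩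
    + (q ℕ.+ (p ∸ j))              ∎
  term : ∀ j → j ≤ p → closedTerm m k p j ≡ coeff n q p j * S₂ (suc m) (n + + suc j)
  term j j≤p = cong₂ _*_
    (cong₂ _*_ (cong₂ _*_ (fallingFactorial≡rising n j) (trans (cong (λ x → binomial⁺ (x - 1ℤ) j) k-p) (binomial⁺≡β q j)))
      (begin
        binomial (+ k - + j) (+ k - + p)                    ≡⟨ cong₂ binomial (k-j j j≤p) k-p ⟩
        binomial⁺ (+ suc (q ℕ.+ (p ∸ j)) - 1ℤ) q            ≡⟨ binomial⁺≡β (suc (q ℕ.+ (p ∸ j))) q ⟩
        β (suc (q ℕ.+ (p ∸ j))) q                           ≡⟨ e≡β q (p ∸ j) ⟨
        e q (p ∸ j)                                         ≡⟨ E≡e q p j j≤p ⟨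
        E q p j                                             ∎))
    (cong₂ (λ x y → + stirling₂ℤ (+ x) y) (ℕ.+-comm m 1) (trans (ℤ.+-assoc n (+ j) 1ℤ) (cong (λ x → n + x) (sym (pos-suc j)))))

-- For j ≤ k the second binomial coefficient has a nonnegative upper and a negative lower index. For
-- j > k both indices are negative and the extended coefficient may be nonzero, but then the lower
-- index of the Stirling number exceeds m + 1.
closedForm-vanish : ∀ m k p → k < p → ∑₀ p (closedTerm m k p) ≡ 0ℤ
closedForm-vanish m k p k<p = ∑<-zero (suc p) λ j _ → term j
  where
  negative : ∃ λ d → + k - + p ≡ -[1+ d ]
  negative with d , d≡ ← ℕ.m≤n⇒∃[o]m+o≡n k<p = d , (begin
    + k - + p                     ≡⟨ cong (λ x → + k - + x) (sym d≡) ⟩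
    + k - (1ℤ + + (k ℕ.+ d))      ≡⟨ cong (λ x → + k - (1ℤ + x)) (ℤ.pos-+ k d) ⟩
    + k - (1ℤ + (+ k + + d))      ≡⟨ lemma (+ k) (+ d) ⟩
    - (1ℤ + + d)                  ∎)
    where
    lemma : ∀ k d → k - (1ℤ + (k + d)) ≡ - (1ℤ + d)
    lemma = solve-∀
  term : ∀ j → closedTerm m k p j ≡ 0ℤ
  term j with ℕ.≤-<-connex j k
  ... | inj₁ j≤k = begin
    f * binomial (+ k - + j) (+ k - + p) * t ≡⟨ cong₂ (λ x y → f * binomial x y * t) (trans (ℤ.m-n≡m⊖n k j) (ℤ.⊖-≥ j≤k)) (proj₂ negative) ⟩
    f * 0ℤ * t                               ≡⟨ lemma f t ⟩
    0ℤ                                       ∎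
    where
    f = fallingFactorial (+ m - + k + + j) j * binomial (+ k - + p - 1ℤ) (+ j)
    t = + stirling₂ℤ (+ m + 1ℤ) (+ m - + k + + j + 1ℤ)
    lemma : ∀ f t → f * 0ℤ * t ≡ 0ℤ
    lemma = solve-∀
  ... | inj₂ k<j with d , refl ← ℕ.m≤n⇒∃[o]m+o≡n k<j = trans (cong (c *_) (cong +_ (begin
    stirling₂ℤ (+ (m ℕ.+ 1)) (+ m - + k + + j + 1ℤ)   ≡⟨ cong (stirling₂ℤ (+ (m ℕ.+ 1))) index ⟩
    stirling₂ (m ℕ.+ 1) (m ℕ.+ 1 ℕ.+ suc d)           ≡⟨ stirling₂-above (m ℕ.+ 1) _ (ℕ.m<m+n (m ℕ.+ 1) (s≤s z≤n)) ⟩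
    0                                                 ∎))) (ℤ.*-zeroʳ c)
    where
    c = fallingFactorial (+ m - + k + + j) j * binomial (+ k - + p - 1ℤ) (+ j) * binomial (+ k - + j) (+ k - + p)
    lemma : ∀ m k d → m - k + (1ℤ + (k + d)) + 1ℤ ≡ m + 1ℤ + (1ℤ + d)
    lemma = solve-∀
    index : + m - + k + + suc (k ℕ.+ d) + 1ℤ ≡ + (m ℕ.+ 1 ℕ.+ suc d)
    index = trans (cong (λ x → + m - + k + (1ℤ + x) + 1ℤ) (ℤ.pos-+ k d)) (lemma (+ m) (+ k) (+ d))

-- Placement numbers: boundary values and the closed form

A-S-vanish : ∀ m K P → K ℤ.< P → A-S m K P ≡ 0
A-S-vanish m (+ k)    (+ p)    (ℤ.+<+ k<p) = cong length (List.filter-none (placement? k p) (All.tabulate {xs = subsets (board m)}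
  λ { {X} _ (refl , _ , refl) → ℕ.<⇒≱ k<p (List.length-filter belowDiagonal? X) }))
A-S-vanish m (+ _)    -[1+ _ ] _ = refl
A-S-vanish m -[1+ _ ] _        _ = refl

A-S-neg : ∀ m K p → A-S m K -[1+ p ] ≡ 0
A-S-neg m (+ _)    p = refl
A-S-neg m -[1+ _ ] p = refl

A-S-0 : ∀ k p → + A-S 0 (+ k) (+ p) ≡ δ k 0 * δ p 0
A-S-0 zero    zero    = refl
A-S-0 zero    (suc p) = refl
A-S-0 (suc k) zero    = refl
A-S-0 (suc k) (suc p) = refl

-- The terms at P - 1 = -1 drop out, and what remains is the recurrence of the Stirling numbers.
A-S-p0 : ∀ m k → + A-S m (+ k) (+ 0) ≡ S₂ (suc m) (+ m - + k + 1ℤ)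
A-S-p0 zero    zero          = refl
A-S-p0 zero    (suc zero)    = refl
A-S-p0 zero    (suc (suc k)) = refl
A-S-p0 (suc m) k = begin
  + A-S (suc m) (+ k) (+ 0)
    ≡⟨ A-S-rec m (+ k) (+ 0) ⟩
  + A-S m (+ k) (+ 0) + (r + 1ℤ) * + A-S m (+ k - 1ℤ) (+ 0) + (+ suc m - 0ℤ) * + A-S m (+ k - 1ℤ) -[1+ 0 ]
    + (+ suc m - 0ℤ) * (r + 1ℤ) * + A-S m (+ k - + 2) -[1+ 0 ]
    ≡⟨ cong₂ (λ x y → + A-S m (+ k) (+ 0) + (r + 1ℤ) * + A-S m (+ k - 1ℤ) (+ 0) + (+ suc m - 0ℤ) * + x + (+ suc m - 0ℤ) * (r + 1ℤ) * + y)
         (A-S-neg m (+ k - 1ℤ) 0) (A-S-neg m (+ k - + 2) 0) ⟩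
  + A-S m (+ k) (+ 0) + (r + 1ℤ) * + A-S m (+ k - 1ℤ) (+ 0) + (+ suc m - 0ℤ) * 0ℤ + (+ suc m - 0ℤ) * (r + 1ℤ) * 0ℤ
    ≡⟨ drop (+ A-S m (+ k) (+ 0)) ((r + 1ℤ) * + A-S m (+ k - 1ℤ) (+ 0)) (+ suc m - 0ℤ) (r + 1ℤ) ⟩
  (r + 1ℤ) * + A-S m (+ k - 1ℤ) (+ 0) + + A-S m (+ k) (+ 0)
    ≡⟨ cong₂ (λ x y → (r + 1ℤ) * x + y) (previous k) (trans (A-S-p0 m k) (cong (S₂ (suc m)) (shift (+ m) (+ k)))) ⟩
  (r + 1ℤ) * S₂ (suc m) (r + 1ℤ) + S₂ (suc m) r
    ≡⟨ S₂-suc′ (suc m) r ⟨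
  S₂ (suc (suc m)) (r + 1ℤ) ∎
  where
  r = + suc m - + k
  drop : ∀ x y z w → x + y + z * 0ℤ + z * w * 0ℤ ≡ y + x
  drop = solve-∀
  shift : ∀ m k → m - k + 1ℤ ≡ 1ℤ + m - k
  shift = solve-∀
  previous : ∀ k → + A-S m (+ k - 1ℤ) (+ 0) ≡ S₂ (suc m) (+ suc m - + k + 1ℤ)
  -- For k = 0 the left side concerns -1 pieces, and the right side is {m + 1, m + 2} = 0.
  previous zero    = sym (cong +_ (trans (cong (λ x → stirling₂ (suc m) (suc x)) (trans (cong (ℕ._+ 1) (ℕ.+-identityʳ m)) (ℕ.+-comm m 1))) (stirling₂-above (suc m) (suc (suc m)) ℕ.≤-refl)))
  previous (suc k) = trans (A-S-p0 m k) (cong (λ x → S₂ (suc m) (x + 1ℤ)) (cancel (+ m) (+ k)))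
    where
    cancel : ∀ m k → m - k ≡ 1ℤ + m - (1ℤ + k)
    cancel = solve-∀

-- With k = p two terms ask for more pieces below the diagonal than there are pieces; the other two
-- form the Stirling recurrence.
A-S-q0 : ∀ m p → + A-S m (+ p) (+ p) ≡ S₂ m (+ m - + p)
A-S-q0 zero    zero    = refl
A-S-q0 zero    (suc p) = refl
A-S-q0 (suc m) p = begin
  + A-S (suc m) (+ p) (+ p)
    ≡⟨ A-S-rec m (+ p) (+ p) ⟩
  + A-S m (+ p) (+ p) + (r + 1ℤ) * + A-S m (+ p - 1ℤ) (+ p) + r * + A-S m (+ p - 1ℤ) (+ p - 1ℤ) + r * (r + 1ℤ) * + A-S m (+ p - + 2) (+ p - 1ℤ)
    ≡⟨ cong₂ (λ x y → + A-S m (+ p) (+ p) + (r + 1ℤ) * + x + r * + A-S m (+ p - 1ℤ) (+ p - 1ℤ) + r * (r + 1ℤ) * + y)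
         (A-S-vanish m (+ p - 1ℤ) (+ p) (subst (+ p - 1ℤ ℤ.<_) (ℤ.+-identityʳ (+ p)) (ℤ.+-monoʳ-< (+ p) ℤ.-<+)))
         (A-S-vanish m (+ p - + 2) (+ p - 1ℤ) (ℤ.+-monoʳ-< (+ p) (ℤ.-<- (s≤s z≤n)))) ⟩
  + A-S m (+ p) (+ p) + (r + 1ℤ) * 0ℤ + r * + A-S m (+ p - 1ℤ) (+ p - 1ℤ) + r * (r + 1ℤ) * 0ℤ
    ≡⟨ drop (+ A-S m (+ p) (+ p)) r (+ A-S m (+ p - 1ℤ) (+ p - 1ℤ)) ⟩
  r * + A-S m (+ p - 1ℤ) (+ p - 1ℤ) + + A-S m (+ p) (+ p)
    ≡⟨ cong₂ (λ x y → r * x + y) (previous p) (trans (A-S-q0 m p) (cong (S₂ m) (shift (+ m) (+ p)))) ⟩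
  r * S₂ m r + S₂ m (r - 1ℤ)
    ≡⟨ S₂-suc m r ⟨
  S₂ (suc m) r ∎
  where
  r = + suc m - + p
  drop : ∀ x r y → x + (r + 1ℤ) * 0ℤ + r * y + r * (r + 1ℤ) * 0ℤ ≡ r * y + x
  drop = solve-∀
  shift : ∀ m p → m - p ≡ 1ℤ + m - p - 1ℤ
  shift = solve-∀
  previous : ∀ p → + A-S m (+ p - 1ℤ) (+ p - 1ℤ) ≡ S₂ m (+ suc m - + p)
  previous zero    = sym (cong +_ (trans (cong (λ x → stirling₂ m (suc x)) (ℕ.+-identityʳ m)) (stirling₂-above m (suc m) ℕ.≤-refl)))
  previous (suc p) = trans (A-S-q0 m p) (cong (S₂ m) (cancel (+ m) (+ p)))
    where
    cancel : ∀ m p → m - p ≡ 1ℤ + m - (1ℤ + p)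
    cancel = solve-∀

-- Induction on m, the pieces being counted as `q` on or above the diagonal and `p` below it. For q,
-- p ≥ 1 the four terms of the recurrence are again of this form, with n shifted by -1, 0, 0 and 1.
A-S≡closedSum : ∀ m q p → + A-S m (+ (q ℕ.+ p)) (+ p) ≡ closedSum (+ m - + (q ℕ.+ p)) m q p
A-S≡closedSum m       q       zero    = trans (A-S-p0 m (q ℕ.+ 0)) (sym (closedSum-p0 (+ m - + (q ℕ.+ 0)) m q))
A-S≡closedSum m       zero    (suc p) = trans (A-S-q0 m (suc p)) (sym (closedSum-q0 m (suc p)))
A-S≡closedSum zero    (suc q) (suc p) = trans (A-S-0 (suc (q ℕ.+ suc p)) (suc p)) (sym (closedSum-m0 q (suc p)))
A-S≡closedSum (suc m) (suc q) (suc p) = begin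
  + A-S (suc m) K P
    ≡⟨ A-S-rec m K P ⟩
  + A-S m K P + (n + 1ℤ) * + A-S m (K - 1ℤ) P + (+ suc m - P) * + A-S m (K - 1ℤ) (P - 1ℤ)
    + (+ suc m - P) * (n + 1ℤ) * + A-S m (K - + 2) (P - 1ℤ)
    ≡⟨ cong₂ _+_ (cong₂ _+_ (cong₂ (λ x y → x + (n + 1ℤ) * y) IH₁ IH₂) (cong₂ _*_ M-P IH₃)) (cong₂ (λ x y → x * (n + 1ℤ) * y) M-P IH₄) ⟩
  closedSum (n - 1ℤ) m (suc q) (suc p) + (n + 1ℤ) * closedSum n m q (suc p) + (n + + suc q) * closedSum n m (suc q) p
    + (n + + suc q) * (n + 1ℤ) * closedSum (n + 1ℤ) m q p
    ≡⟨ closedSum-rec n m q p ⟨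
  closedSum n (suc m) (suc q) (suc p) ∎
  where
  k = suc q ℕ.+ suc p
  K = + k
  P = + suc p
  n = + suc m - K
  k≡ : k ≡ suc (suc (q ℕ.+ p))
  k≡ = cong suc (ℕ.+-suc q p)
  IH₁ : + A-S m K P ≡ closedSum (n - 1ℤ) m (suc q) (suc p)
  IH₁ = trans (A-S≡closedSum m (suc q) (suc p)) (cong (λ x → closedSum x m (suc q) (suc p)) (lemma (+ m) K))
    where
    lemma : ∀ m K → m - K ≡ 1ℤ + m - K - 1ℤ
    lemma = solve-∀
  IH₂ : + A-S m (K - 1ℤ) P ≡ closedSum n m q (suc p)
  IH₂ = trans (A-S≡closedSum m q (suc p)) (cong (λ x → closedSum x m q (suc p)) (lemma (+ m) (+ (q ℕ.+ suc p))))
    where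
    lemma : ∀ m K → m - K ≡ 1ℤ + m - (1ℤ + K)
    lemma = solve-∀
  IH₃ : + A-S m (K - 1ℤ) (P - 1ℤ) ≡ closedSum n m (suc q) p
  IH₃ = begin
    + A-S m (K - 1ℤ) (+ p)                ≡⟨ cong (λ x → + A-S m (+ x) (+ p)) (ℕ.+-suc q p) ⟩
    + A-S m (+ (suc q ℕ.+ p)) (+ p)       ≡⟨ A-S≡closedSum m (suc q) p ⟩
    closedSum (+ m - + (suc q ℕ.+ p)) m (suc q) p ≡⟨ cong (λ x → closedSum x m (suc q) p) (trans (lemma (+ m) (+ (suc q ℕ.+ p))) (cong (λ x → + suc m - + x) (sym k≡))) ⟩
    closedSum n m (suc q) p                       ∎
    where
    lemma : ∀ m K → m - K ≡ 1ℤ + m - (1ℤ + K)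
    lemma = solve-∀
  IH₄ : + A-S m (K - + 2) (P - 1ℤ) ≡ closedSum (n + 1ℤ) m q p
  IH₄ = begin
    + A-S m (K - + 2) (+ p)               ≡⟨ cong (λ x → + A-S m (+ x - + 2) (+ p)) k≡ ⟩
    + A-S m (+ (q ℕ.+ p)) (+ p)           ≡⟨ A-S≡closedSum m q p ⟩
    closedSum (+ m - + (q ℕ.+ p)) m q p           ≡⟨ cong (λ x → closedSum x m q p) (trans (lemma (+ m) (+ (q ℕ.+ p))) (cong (λ x → + suc m - + x + 1ℤ) (sym k≡))) ⟩
    closedSum (n + 1ℤ) m q p                      ∎
    where
    lemma : ∀ m K → m - K ≡ 1ℤ + m - (1ℤ + (1ℤ + K)) + 1ℤ
    lemma = solve-∀
  M-P : + suc m - P ≡ n + + suc q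
  M-P = trans (lemma (+ suc m) P (+ suc q)) (cong (λ x → + suc m - x + + suc q) (sym (ℤ.pos-+ (suc q) (suc p))))
    where
    lemma : ∀ M P Q → M - P ≡ M - (Q + P) + Q
    lemma = solve-∀

A-S-k0 : ∀ m p → + A-S m (+ 0) (+ p) ≡ δ p 0
A-S-k0 m zero    = trans (A-S-q0 m 0) (trans (cong (λ x → + stirling₂ m x) (ℕ.+-identityʳ m)) (cong +_ (stirling₂-diag m)))
A-S-k0 m (suc p) = cong +_ (A-S-vanish m (+ 0) (+ suc p) (ℤ.+<+ (s≤s z≤n)))

-- For a single piece, p = 0 and p = 1 are the cases of no piece and of all pieces below the
-- diagonal, both already known.
A-S-k1 : ∀ m p → + A-S m (+ 1) (+ p) ≡ + stirling₂ℤ (+ m + 1ℤ) (+ m) * δ p 0 + + stirling₂ℤ (+ m) (+ m - 1ℤ) * δ p 1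
A-S-k1 m zero = begin
  + A-S m (+ 1) (+ 0)                                    ≡⟨ A-S-p0 m 1 ⟩
  S₂ (suc m) (+ m - 1ℤ + 1ℤ)                              ≡⟨ cong₂ S₂ (ℕ.+-comm 1 m) (cancel (+ m)) ⟩
  + stirling₂ℤ (+ m + 1ℤ) (+ m)                          ≡⟨ lemma (+ stirling₂ℤ (+ m + 1ℤ) (+ m)) (S₂ m (+ m - 1ℤ)) ⟩
  + stirling₂ℤ (+ m + 1ℤ) (+ m) * 1ℤ + S₂ m (+ m - 1ℤ) * 0ℤ ∎
  where
  cancel : ∀ m → m - 1ℤ + 1ℤ ≡ m
  cancel = solve-∀
  lemma : ∀ x y → x ≡ x * 1ℤ + y * 0ℤ
  lemma = solve-∀
A-S-k1 m (suc zero) = trans (A-S-q0 m 1) (lemma (+ stirling₂ℤ (+ m + 1ℤ) (+ m)) (S₂ m (+ m - 1ℤ)))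
  where
  lemma : ∀ x y → y ≡ x * 0ℤ + y * 1ℤ
  lemma = solve-∀
A-S-k1 m (suc (suc p)) = trans
  (cong +_ (A-S-vanish m (+ 1) (+ suc (suc p)) (ℤ.+<+ (s≤s (s≤s z≤n)))))
  (lemma (+ stirling₂ℤ (+ m + 1ℤ) (+ m)) (S₂ m (+ m - 1ℤ)))
  where
  lemma : ∀ x y → 0ℤ ≡ x * 0ℤ + y * 0ℤ
  lemma = solve-∀

A-S-closedForm : ∀ m k p → + A-S m (+ k) (+ p) ≡ ∑₀ p (closedTerm m k p)
A-S-closedForm m k p with ℕ.≤-<-connex p k
... | inj₂ k<p = trans (cong +_ (A-S-vanish m (+ k) (+ p) (ℤ.+<+ k<p))) (sym (closedForm-vanish m k p k<p))
... | inj₁ p≤k = subst (λ k → + A-S m (+ k) (+ p) ≡ ∑₀ p (closedTerm m k p)) (ℕ.m∸n+n≡m p≤k)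
  (trans (A-S≡closedSum m (k ℕ.∸ p) p) (sym (closedForm≡closedSum m (k ℕ.∸ p) p)))

theorem3p1 : (∀ (m k p : ℕ) → 1 ℕ.≤ m →
    + A-S m (+ k) (+ p)
    ≡ + A-S (m ℕ.∸ 1) (+ k) (+ p)
    + (+ m - + k + 1ℤ) * + A-S (m ℕ.∸ 1) (+ k - 1ℤ) (+ p)
    + (+ m - + p) * + A-S (m ℕ.∸ 1) (+ k - 1ℤ) (+ p - 1ℤ)
    + (+ m - + p) * (+ m - + k + 1ℤ) * + A-S (m ℕ.∸ 1) (+ k - + 2) (+ p - 1ℤ))
    × (∀ (k p : ℕ) → + A-S 0 (+ k) (+ p) ≡ δ k 0 * δ p 0)
    × (∀ (m p : ℕ) → + A-S m (+ 0) (+ p) ≡ δ p 0)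
    × (∀ (m p : ℕ) →
    + A-S m (+ 1) (+ p)
    ≡ + stirling₂ℤ (+ m + 1ℤ) (+ m) * δ p 0 + + stirling₂ℤ (+ m) (+ m - 1ℤ) * δ p 1)
    × (∀ (m k : ℕ) → A-S m (+ k) (+ 0) ≡ stirling₂ℤ (+ m + 1ℤ) (+ m - + k + 1ℤ))
    × (∀ (m k p : ℕ) →
    + A-S m (+ k) (+ p)
    ≡ ∑[ j from0to p ]
    (fallingFactorial (+ m - + k + + j) j
    * binomial (+ k - + p - 1ℤ) (+ j)
    * binomial (+ k - + j) (+ k - + p)
    * + stirling₂ℤ (+ m + 1ℤ) (+ m - + k + + j + 1ℤ)))
theorem3p1 =
    (λ { (suc m) k p _ → A-S-rec m (+ k) (+ p) })
  , A-S-0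
  , A-S-k0
  , A-S-k1
  , (λ m k → ℤ.+-injective (trans (A-S-p0 m k) (cong (λ x → + stirling₂ℤ (+ x) (+ m - + k + 1ℤ)) (ℕ.+-comm 1 m))))
  , A-S-closedForm
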